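{- For every even integer $b\ge 2$, the graph $EG(b)$ with degree function $f$ and $f$-matching $M$ defined in the context contains the $b$ blossoms $B_1,\dots,B_b$ and has $\Theta(b)$ vertices and $\Theta(b)$ edges. A shortest augmenting trail (sat) for $M$ has length $4b+1$. For each $i=1,\dots,b$ the trail $T_i$ that uses the cross edge at $\beta_i$ is a sat, and $EG(b)$ has $\Theta(b^2)$ petalevels.
   Context: Matchings. An $f$-matching is a set $M$ of edges such that every vertex $v$ has degree at most $f(v)$ in $M$; $v$ is free if the inequality is strict. The M-type of an edge is matched (in $M$) or unmatched. A trail may repeat vertices but not edges; its length is its number of edges. It is alternating if consecutive edges have opposite M-types (the first and last edges of a closed trail are not consecutive). An augmenting trail $A$ is an alternating trail that begins and ends at a free vertex, such that $M\oplus A$ is an $f$-matching. A sat is an augmenting trail of minimum length. The graph $EG(b)$, $b\ge 2$ even. Vertices: $\beta_1,\dots,\beta_b$; $\beta_1'$; $s_{11}$; $s_{i1},s_{i2},s_{i3}$ for $2\le i\le b$; and $p_0,\dots,p_{3b-2}$. For $i\ge2$ write $s_{i4}=s_{i-1,1}$ (so $s_{24}=s_{11}$). Edges and M-types: (1) the triangle $\beta_1,\beta_1',s_{24}$, with $\beta_1\beta_1'$ and $\beta_1s_{24}$ matched and $\beta_1's_{24}$ unmatched; (2) for each $i=2,\dots,b$, the path of 5 edges $\beta_{i-1},\beta_i,s_{i1},s_{i2},s_{i3},s_{i4}$. For $i$ odd, $\beta_{i-1}\beta_i$, $\beta_is_{i1}$, $s_{i2}s_{i3}$ are matched and $s_{i1}s_{i2}$,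 $s_{i3}s_{i4}$ are unmatched. For $i$ even all five M-types are reversed; (3) the path $p_0,p_1,\dots,p_{3b-2}$, with $p_kp_{k+1}$ unmatched iff $k$ is even; (4) for each $i=1,\dots,b$ the cross edge $\beta_ip_{1+3(b-i)}$, unmatched iff $i$ is odd. (The path in (3) followed by the cross edge $p_{3b-2}\beta_1$ is an alternating path of length $3b-1$.) The vertices $p_0$ and $\beta_b$ are free with deficiency 1 (i.e. $f$ exceeds the degree in $M$ by 1). Every other vertex $v$ has $f(v)$ equal to its degree in $M$, which is 1 or 2. The blossoms. $B_1$ is the triangle of (1). For $i\ge 2$, $B_i$ is $B_{i-1}$ together with the path of (2) for $i$. $B_i$ has base vertex $\beta_i$, and the two edges of $B_i$ descending from $\beta_i$ (the edges of $B_i$ incident to $\beta_i$, apart from those at the triangle counted in the same way for $i=1$) have the same M-type: matched for $i$ odd ($B_i$ is heavy), unmatched for $i$ even ($B_i$ is light). The base edge of $B_i$ is $\beta_i\beta_{i+1}$ for $i<b$; for $i=b$ it is an artificial matched edge to $\beta_b$ from an artificial vertex. Any other edge with exactly one end in $V(B_i)$ is a petal of $B_i$. In the search structure in which the sats are discovered (for the weighted $f$-matching search with edge weights 2 on matched and 0 on unmatched edges) every $B_i$ is a positive blossom, i.e. has a positive dual value. The trails. Let $S=s_{i1}s_{i2}s_{i3}s_{i4}\,s_{i-1,2}s_{i-1,3}s_{i-1,4}\cdots s_{22}s_{23}s_{24}$ for $i>1$ and $S=s_{24}$ for $i=1$. Then $T_i$ is the trail $$\beta_b\beta_{b-1}\cdots\beta_i\;S\;\beta_1'\beta_1\beta_2\cdots\beta_i\;p_{1+3(b-i)}\,p_{3(b-i)}\cdots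 p_0 .$$ Petalevels. If a trail from a free vertex, beginning with an unmatched edge, reaches a vertex $v$ after $k$ edges, then $v$ occurs on level $k$ of the trail. An ordinary level of $v$ is formed by a shortest such alternating trail ending at $v$ in an edge of given M-type; it enters every positive blossom containing $v$ on its base edge. The other levels of $v$ in sats, where at least one positive blossom containing $v$ is entered on a petal, are its petalevels. They are counted over all vertices. For example, for $j<i$ the vertex $\beta_j$ occurs on petalevel $b+2i+j-1$ of $T_i$, after $T_i$ enters $B_j$ on its petal $s_{j+1,3}s_{j+1,4}$. The constants in the $\Theta(\cdot)$ bounds are absolute.
   Formalization: An augmenting trail is additionally required to begin and end with an unmatched edge; without this, the trail β_b p_1 p_0 of length 2 (or an empty trail at a free vertex) would be augmenting and the sat length 4b+1 would be false. -}

module Defs where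

open import Data.Bool.Base using (Bool; true; false; not; if_then_else_; _∨_; _xor_)
open import Data.List.Base using (List; []; _∷_; _++_; [_]; map; applyUpTo; downFrom; drop; head; last; length; reverse; upTo)
open import Data.List.Membership.Propositional using (_∈_; _∉_)
open import Data.List.Membership.Propositional.Properties using (∈-map⁺; ∈-++⁺ˡ; ∈-++⁺ʳ; ∈-applyUpTo⁺; ∈-applyUpTo⁻)
open import Data.List.Relation.Binary.Disjoint.Propositional using (Disjoint)
open import Data.List.Relation.Unary.All as All using (All; []; _∷_)
import Data.List.Relation.Unary.All.Properties as All
open import Data.List.Relation.Unary.AllPairs using (AllPairs; []; _∷_)
open import Data.List.Relation.Unary.Any using (here; there)
open import Data.List.Relation.Unary.Linked using (Linked)
open import Data.List.Relation.Unary.Unique.Propositional using (Unique)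
import Data.List.Relation.Unary.Unique.Propositional.Properties as Unique
open import Data.Maybe.Base using (just; maybe′)
import Data.Maybe.Relation.Unary.All as MaybeAll
import Data.Maybe.Relation.Unary.Any as MaybeAny
open import Data.Nat.Base using (ℕ; zero; suc; _+_; _*_; _∸_; _≤_; _<_; z≤n; s≤s)
open import Data.Nat.ListAction using (sum)
import Data.Nat.Properties as ℕ
open import Data.Product.Base using (Σ; ∃; ∃-syntax; _×_; _,_; proj₁; proj₂)
open import Data.Product.Properties using (≡-dec)
open import Data.Sum.Base using (_⊎_)
open import Function.Base using (_∘_)
open import Function.Bundles using (mk↣)
open import Relation.Binary.Definitions using (DecidableEquality)
open import Relation.Binary.PropositionalEquality using (_≡_; _≢_; refl; sym; trans; cong; subst)
open import Relation.Nullary using (¬_)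
open import Relation.Nullary.Decidable using (does; via-injection)
import Data.List.Membership.DecPropositional as DecMembership

-- The M-type of an edge e is the value M e, where an edge set M is
-- given by its characteristic function.
pattern matched   = true
pattern unmatched = false

indicator : Bool → ℕ
indicator c = if c then 1 else 0

_at_is_ : {A : Set} → List A → ℕ → A → Set
xs at k is x = head (drop k xs) ≡ just x

-- Lower and upper bounds on the number of elements satisfying P, stated
-- without deciding P.
AtLeast AtMost : {A : Set} → ℕ → (A → Set) → Set
AtLeast m P = ∃[ xs ] Unique xs × All P xs × m ≤ length xs
AtMost  m P = ∀ xs → Unique xs → All P xs → length xs ≤ m

-- Vertex and Edge are types of names; only the listed names belong to
-- the graph.
record Graph : Set₁ where
  field
    Vertex Edge     : Set
    _≟ⱽ_            : DecidableEquality Vertex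
    _≟ᴱ_            : DecidableEquality Edge
    vertices        : List Vertex
    edges           : List Edge
    ends            : Edge → Vertex × Vertex
    vertices-unique : Unique vertices
    edges-unique    : Unique edges
    ends-vertices   : All (λ e → proj₁ (ends e) ∈ vertices × proj₂ (ends e) ∈ vertices) edges

  order size : ℕ
  order = length vertices
  size  = length edges

module Degree (G : Graph) where
  open Graph G

  -- A loop counts twice.
  degree : (Edge → Bool) → Vertex → ℕ
  degree N v = sum (map (λ e → if N e then endsAt (ends e) else 0) edges)
    where
    endsAt : Vertex × Vertex → ℕ
    endsAt (x , y) = indicator (does (x ≟ⱽ v)) + indicator (does (y ≟ⱽ v))

module Matching (G : Graph) (f : Graph.Vertex G → ℕ) (M : Graph.Edge G → Bool) where
  open Graph G
  open Degree G public
  open DecMembership _≟ᴱ_ using (_∈?_)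

  Joins : Edge → Vertex → Vertex → Set
  Joins e u v = (ends e ≡ (u , v)) ⊎ (ends e ≡ (v , u))

  IsFMatching : (Edge → Bool) → Set
  IsFMatching N = ∀ {v} → v ∈ vertices → degree N v ≤ f v

  Free : Vertex → Set
  Free v = v ∈ vertices × degree M v < f v

  data IsWalk {Node : Set} (J : Edge → Node → Node → Set) : List Node → List Edge → Set where
    single : ∀ {x} → IsWalk J (x ∷ []) []
    step   : ∀ {x y xs e es} → e ∈ edges → J e x y →
             IsWalk J (y ∷ xs) es → IsWalk J (x ∷ y ∷ xs) (e ∷ es)

  record Trail : Set where
    field
      verts    : List Vertex
      route    : List Edge
      isWalk   : IsWalk Joins verts route
      distinct : Unique route

  open Trail public

  len : Trail → ℕ
  len A = length (route A)

  Alternating : Trail → Set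
  Alternating A = Linked (λ e e′ → M e ≢ M e′) (route A)

  _⊕_ : (Edge → Bool) → Trail → Edge → Bool
  (N ⊕ A) e = N e xor does (e ∈? route A)

  -- The end edges are required to be unmatched, so that augmenting by A
  -- enlarges M.  The remaining conditions do not imply this when an end
  -- vertex is free and also on a matched edge.
  record IsAugmenting (A : Trail) : Set where
    field
      alternating      : Alternating A
      starts-free      : MaybeAny.Any Free (head (verts A))
      ends-free        : MaybeAny.Any Free (last (verts A))
      starts-unmatched : MaybeAny.Any (λ e → M e ≡ unmatched) (head (route A))
      ends-unmatched   : MaybeAny.Any (λ e → M e ≡ unmatched) (last (route A))
      result           : IsFMatching (M ⊕ A)

  IsSat : Trail → Set
  IsSat A = IsAugmenting A × (∀ A′ → IsAugmenting A′ → len A ≤ len A′)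

  -- A node of a contracted graph: a vertex of G, or the contraction of
  -- the blossom formed by the closed trail α, xs, α with edges es, whose
  -- nodes may themselves be contracted blossoms.
  data Node : Set where
    atom    : Vertex → Node
    blossom : (α : Node) (xs : List Node) (es : List Edge) → Node

  V[_]  : Node → List Vertex
  V*[_] : List Node → List Vertex
  V[ atom v ]         = v ∷ []
  V[ blossom α xs _ ] = V[ α ] ++ V*[ xs ]
  V*[ [] ]     = []
  V*[ x ∷ xs ] = V[ x ] ++ V*[ xs ]

  JoinsNodes : Edge → Node → Node → Set
  JoinsNodes e x y = ∃[ u ] ∃[ v ] u ∈ V[ x ] × v ∈ V[ y ] × Joins e u v

  -- Nodes of one contracted graph are disjoint; a closed trail may
  -- repeat a vertex that is not contracted.
  Compatible : Node → Node → Set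
  Compatible x y = (∃[ v ] x ≡ atom v × y ≡ atom v) ⊎ Disjoint V[ x ] V[ y ]

  record IsClosedTrail (α : Node) (xs : List Node) (es : List Edge) : Set where
    field
      isWalk     : IsWalk JoinsNodes (α ∷ xs ++ [ α ]) es
      distinct   : Unique es
      compatible : AllPairs Compatible (α ∷ xs)

  -- The base edge of a blossom x with base vertex v and M-type t.
  -- Membership in the graph is not required, so as to admit an
  -- artificial base edge.
  IsBaseEdge : Node → Vertex → Bool → Edge → Set
  IsBaseEdge x v t e = M e ≡ not t × ∃[ w ] w ∉ V[ x ] × Joins e v w

  -- Blossoms for f-matchings, following Gabow.  IsBlossom x v t: x is a
  -- blossom with base vertex v and M-type t; it is heavy if t is
  -- matched and light if t is unmatched.
  mutual
    data IsBlossom : Node → Vertex → Bool → Set where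
      atomBase    : ∀ {v xs es t} → IsClosedTrail (atom v) xs es → Turns es xs →
                    MaybeAny.Any (λ e → M e ≡ t) (head es) →
                    MaybeAny.Any (λ e → M e ≡ t) (last es) →
                    IsBlossom (blossom (atom v) xs es) v t
      -- At least one other node, as contracting α deletes its loops.
      blossomBase : ∀ {α v x xs es t} → IsBlossom α v t →
                    IsClosedTrail α (x ∷ xs) es → Turns es (x ∷ xs) →
                    IsBlossom (blossom α (x ∷ xs) es) v t

    data Turns : List Edge → List Node → Set where
      end  : ∀ {e} → Turns (e ∷ []) []
      turn : ∀ {e e′ es x xs} → Turn e x e′ → Turns (e′ ∷ es) xs → Turns (e ∷ e′ ∷ es) (x ∷ xs)

    data Turn (e : Edge) : Node → Edge → Set where
      atAtom    : ∀ {v e′} → M e ≢ M e′ → Turn e (atom v) e′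
      atBlossom : ∀ {x v t e′} → IsBlossom x v t →
                  IsBaseEdge x v t e ⊎ IsBaseEdge x v t e′ → Turn e x e′

  IsPetal : Node → Edge → Edge → Set
  IsPetal x η e = (∃[ u ] ∃[ w ] Joins e u w × u ∉ V[ x ] × w ∈ V[ x ]) × e ≢ η

  -- The occurrence of a vertex on level k of A lies in x, and e is the
  -- edge on which A last entered x before it.
  Enters : Trail → Node → ℕ → Edge → Set
  Enters A x k e = ∃[ l ] ∃[ u ] l < k × verts A at l is u × u ∉ V[ x ] × route A at l is e
                   × (∀ m w → l < m → m ≤ k → verts A at m is w → w ∈ V[ x ])

  -- An empty trail counts as ending in an artificial matched edge at its
  -- free vertex.
  record Reaches (A : Trail) (v : Vertex) (t : Bool) : Set where
    field
      alternating      : Alternating A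
      starts-free      : MaybeAny.Any Free (head (verts A))
      starts-unmatched : MaybeAll.All (λ e → M e ≡ unmatched) (head (route A))
      ends-at          : last (verts A) ≡ just v
      ends-type        : maybe′ M matched (last (route A)) ≡ t

  IsOrdinaryLevel : Vertex → ℕ → Set
  IsOrdinaryLevel v k = ∃[ t ] ∃[ A ] Reaches A v t × len A ≡ k
                        × (∀ A′ → Reaches A′ v t → k ≤ len A′)

  -- positive lists the positive blossoms, each with its base edge.
  IsPetalevel : List (Node × Edge) → Vertex × ℕ → Set
  IsPetalevel positive (v , k) =
    (∃[ A ] IsSat A × verts A at k is v
       × ∃[ B ] ∃[ η ] (B , η) ∈ positive × ∃[ e ] Enters A B k e × IsPetal B η e)
    × ¬ IsOrdinaryLevel v k

odd : ℕ → Bool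
odd zero    = false
odd (suc n) = not (odd n)

[_⋯_] : ℕ → ℕ → List ℕ
[ m ⋯ n ] = applyUpTo (m +_) (suc n ∸ m)

-- s i j is used for j = 1, 2, 3 only.
data Vertex : Set where
  β   : ℕ → Vertex
  β₁′ : Vertex
  s   : ℕ → ℕ → Vertex
  p   : ℕ → Vertex

s₄ : ℕ → Vertex
s₄ i = s (i ∸ 1) 1

-- ββ i, βs i, ss₁ i, ss₂ i, ss₃ i are the successive edges of the path
-- β_{i-1}, β_i, s_{i1}, s_{i2}, s_{i3}, s_{i4}.
data Edge : Set where
  β₁β₁′ β₁s₂₄ β₁′s₂₄     : Edge
  ββ βs ss₁ ss₂ ss₃      : ℕ → Edge
  pp cross               : ℕ → Edge

M : Edge → Bool
M β₁β₁′     = matched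
M β₁s₂₄     = matched
M β₁′s₂₄    = unmatched
M (ββ i)    = odd i
M (βs i)    = odd i
M (ss₁ i)   = not (odd i)
M (ss₂ i)   = odd i
M (ss₃ i)   = not (odd i)
M (pp k)    = odd k
M (cross i) = not (odd i)

vertexCode : Vertex → ℕ × ℕ
vertexCode (p k)   = 0 , k
vertexCode (β i)   = 1 , i
vertexCode β₁′     = 2 , 0
vertexCode (s i j) = 3 + j , i

vertexCode-injective : ∀ {x y} → vertexCode x ≡ vertexCode y → x ≡ y
vertexCode-injective {p _}   {p _}   refl = refl
vertexCode-injective {β _}   {β _}   refl = refl
vertexCode-injective {β₁′}   {β₁′}   refl = refl
vertexCode-injective {s _ _} {s _ _} refl = refl

edgeCode : Edge → ℕ × ℕ
edgeCode β₁β₁′     = 0 , 0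
edgeCode β₁s₂₄     = 0 , 1
edgeCode β₁′s₂₄    = 0 , 2
edgeCode (ββ i)    = 1 , i
edgeCode (βs i)    = 2 , i
edgeCode (ss₁ i)   = 3 , i
edgeCode (ss₂ i)   = 4 , i
edgeCode (ss₃ i)   = 5 , i
edgeCode (pp k)    = 6 , k
edgeCode (cross i) = 7 , i

edgeDecode : ℕ × ℕ → Edge
edgeDecode (0 , 0) = β₁β₁′
edgeDecode (0 , 1) = β₁s₂₄
edgeDecode (0 , _) = β₁′s₂₄
edgeDecode (1 , i) = ββ i
edgeDecode (2 , i) = βs i
edgeDecode (3 , i) = ss₁ i
edgeDecode (4 , i) = ss₂ i
edgeDecode (5 , i) = ss₃ i
edgeDecode (6 , k) = pp k
edgeDecode (_ , i) = cross i

edgeDecode-edgeCode : ∀ e → edgeDecode (edgeCode e) ≡ e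
edgeDecode-edgeCode β₁β₁′     = refl
edgeDecode-edgeCode β₁s₂₄     = refl
edgeDecode-edgeCode β₁′s₂₄    = refl
edgeDecode-edgeCode (ββ _)    = refl
edgeDecode-edgeCode (βs _)    = refl
edgeDecode-edgeCode (ss₁ _)   = refl
edgeDecode-edgeCode (ss₂ _)   = refl
edgeDecode-edgeCode (ss₃ _)   = refl
edgeDecode-edgeCode (pp _)    = refl
edgeDecode-edgeCode (cross _) = refl

_≟ⱽ_ : DecidableEquality Vertex
_≟ⱽ_ = via-injection (mk↣ vertexCode-injective) (≡-dec ℕ._≟_ ℕ._≟_)

edgeCode-injective : ∀ {x y} → edgeCode x ≡ edgeCode y → x ≡ y
edgeCode-injective {x} {y} eq =
  trans (sym (edgeDecode-edgeCode x)) (trans (cong edgeDecode eq) (edgeDecode-edgeCode y))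

_≟ᴱ_ : DecidableEquality Edge
_≟ᴱ_ = via-injection (mk↣ edgeCode-injective) (≡-dec ℕ._≟_ ℕ._≟_)

module _ {A : Set} (grade : A → ℕ) where

  -- Distinct elements, all of grade at least k.
  Graded : ℕ → List A → Set
  Graded k xs = Unique xs × All (λ x → k ≤ grade x) xs

  graded-[] : ∀ {k} → Graded k []
  graded-[] = [] , []

  graded-skip : ∀ {k xs} → Graded (suc k) xs → Graded k xs
  graded-skip (uxs , kxs) = uxs , All.map ℕ.<⇒≤ kxs

  graded-++ : ∀ {k xs ys} → Unique xs → All (λ x → grade x ≡ k) xs →
              Graded (suc k) ys → Graded k (xs ++ ys)
  graded-++ {k} uxs kxs (uys , kys) =
    Unique.++⁺ uxs uys
      (λ (x∈xs , x∈ys) → ℕ.<-irrefl (sym (All.lookup kxs x∈xs)) (All.lookup kys x∈ys))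
    , All.++⁺ (All.map (ℕ.≤-reflexive ∘ sym) kxs) (All.map (ℕ.≤-trans (ℕ.n≤1+n k)) kys)

  graded-map : ∀ {k ns ys} (c : ℕ → A) → (∀ {m n} → c m ≡ c n → m ≡ n) →
               (∀ n → grade (c n) ≡ k) → Unique ns →
               Graded (suc k) ys → Graded k (map c ns ++ ys)
  graded-map {ns = ns} c c-inj gr uns =
    graded-++ (Unique.map⁺ c-inj uns) (All.map⁺ (All.universal gr ns))

range-unique : ∀ m n → Unique [ m ⋯ n ]
range-unique m n = Unique.applyUpTo⁺₁ (m +_) (suc n ∸ m)
  (λ i<j _ eq → ℕ.<⇒≢ i<j (ℕ.+-cancelˡ-≡ m _ _ eq))

∈-range⁺ : ∀ {m n i} → m ≤ i → i ≤ n → i ∈ [ m ⋯ n ]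
∈-range⁺ {m} {n} {i} m≤i i≤n =
  subst (_∈ [ m ⋯ n ]) (ℕ.m+[n∸m]≡n m≤i)
    (∈-applyUpTo⁺ (m +_) (subst (_≤ suc n ∸ m) (ℕ.+-∸-assoc 1 m≤i) (ℕ.∸-monoˡ-≤ m (s≤s i≤n))))

∈-range⁻ : ∀ {m n i} → i ∈ [ m ⋯ n ] → m ≤ i × i ≤ n
∈-range⁻ {m} {n} i∈ with ∈-applyUpTo⁻ (m +_) i∈
... | j , j< , refl = ℕ.m≤m+n m j , ℕ.≤-pred (ℕ.≤-trans (ℕ.≤-reflexive (sym (ℕ.+-suc m j)))
  (ℕ.≤-trans (ℕ.+-monoʳ-≤ m j<) (ℕ.≤-reflexive (ℕ.m+[n∸m]≡n (m≤1+n j<)))))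
  where
  m≤1+n : ∀ {j} → j < suc n ∸ m → m ≤ suc n
  m≤1+n {j} j< = ℕ.<⇒≤ (ℕ.m∸n≢0⇒n<m (λ eq → ℕ.n≮0 (subst (j <_) eq j<)))

module EG (b : ℕ) (b≥2 : 2 ≤ b) where

  private
    vertices : List Vertex
    vertices = map p [ 0 ⋯ 3 * b ∸ 2 ]
            ++ map β [ 1 ⋯ b ]
            ++ [ β₁′ ]
            ++ map (λ i → s i 1) [ 1 ⋯ b ]
            ++ map (λ i → s i 2) [ 2 ⋯ b ]
            ++ map (λ i → s i 3) [ 2 ⋯ b ]
            ++ []

    edges : List Edge
    edges = (β₁β₁′ ∷ β₁s₂₄ ∷ β₁′s₂₄ ∷ [])
         ++ map ββ  [ 2 ⋯ b ]
         ++ map βs  [ 2 ⋯ b ]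
         ++ map ss₁ [ 2 ⋯ b ]
         ++ map ss₂ [ 2 ⋯ b ]
         ++ map ss₃ [ 2 ⋯ b ]
         ++ map pp (upTo (3 * b ∸ 2))
         ++ map cross [ 1 ⋯ b ]
         ++ []

    ends : Edge → Vertex × Vertex
    ends β₁β₁′     = β 1 , β₁′
    ends β₁s₂₄     = β 1 , s₄ 2
    ends β₁′s₂₄    = β₁′ , s₄ 2
    ends (ββ i)    = β (i ∸ 1) , β i
    ends (βs i)    = β i , s i 1
    ends (ss₁ i)   = s i 1 , s i 2
    ends (ss₂ i)   = s i 2 , s i 3
    ends (ss₃ i)   = s i 3 , s₄ i
    ends (pp k)    = p k , p (suc k)
    ends (cross i) = β i , p (1 + 3 * (b ∸ i))

    vertices-unique : Unique vertices
    vertices-unique = proj₁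
      (graded-map grade p (λ { refl → refl }) (λ _ → refl) (range-unique 0 (3 * b ∸ 2))
      (graded-map grade β (λ { refl → refl }) (λ _ → refl) (range-unique 1 b)
      (graded-++ grade ([] ∷ []) (refl ∷ [])
      (graded-skip grade
      (graded-map grade (λ i → s i 1) (λ { refl → refl }) (λ _ → refl) (range-unique 1 b)
      (graded-map grade (λ i → s i 2) (λ { refl → refl }) (λ _ → refl) (range-unique 2 b)
      (graded-map grade (λ i → s i 3) (λ { refl → refl }) (λ _ → refl) (range-unique 2 b)
      (graded-[] grade))))))))
      where
      grade : Vertex → ℕ
      grade v = proj₁ (vertexCode v)

    edges-unique : Unique edges
    edges-unique = proj₁
      (graded-++ grade (((λ ()) ∷ (λ ()) ∷ []) ∷ ((λ ()) ∷ []) ∷ [] ∷ []) (refl ∷ refl ∷ refl ∷ [])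
      (graded-map grade ββ    (λ { refl → refl }) (λ _ → refl) (range-unique 2 b)
      (graded-map grade βs    (λ { refl → refl }) (λ _ → refl) (range-unique 2 b)
      (graded-map grade ss₁   (λ { refl → refl }) (λ _ → refl) (range-unique 2 b)
      (graded-map grade ss₂   (λ { refl → refl }) (λ _ → refl) (range-unique 2 b)
      (graded-map grade ss₃   (λ { refl → refl }) (λ _ → refl) (range-unique 2 b)
      (graded-map grade pp    (λ { refl → refl }) (λ _ → refl) (Unique.upTo⁺ (3 * b ∸ 2))
      (graded-map grade cross (λ { refl → refl }) (λ _ → refl) (range-unique 1 b)
      (graded-[] grade)))))))))
      where
      grade : Edge → ℕ
      grade e = proj₁ (edgeCode e)

    afterβ : ∀ {v ws} → v ∈ ws → v ∈ map p [ 0 ⋯ 3 * b ∸ 2 ] ++ map β [ 1 ⋯ b ] ++ ws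
    afterβ v∈ = ∈-++⁺ʳ (map p [ 0 ⋯ 3 * b ∸ 2 ]) (∈-++⁺ʳ (map β [ 1 ⋯ b ]) v∈)

    p∈ : ∀ {k} → k ≤ 3 * b ∸ 2 → p k ∈ vertices
    p∈ k≤ = ∈-++⁺ˡ {xs = map p [ 0 ⋯ 3 * b ∸ 2 ]} (∈-map⁺ p (∈-range⁺ z≤n k≤))

    β∈ : ∀ {i} → 1 ≤ i → i ≤ b → β i ∈ vertices
    β∈ 1≤i i≤b = ∈-++⁺ʳ (map p [ 0 ⋯ 3 * b ∸ 2 ]) (∈-++⁺ˡ (∈-map⁺ β (∈-range⁺ 1≤i i≤b)))

    β₁′∈ : β₁′ ∈ vertices
    β₁′∈ = afterβ (here refl)

    s₁∈ : ∀ {i} → 1 ≤ i → i ≤ b → s i 1 ∈ vertices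
    s₁∈ 1≤i i≤b = afterβ (there
      (∈-++⁺ˡ (∈-map⁺ (λ i → s i 1) (∈-range⁺ 1≤i i≤b))))

    s₂∈ : ∀ {i} → 2 ≤ i → i ≤ b → s i 2 ∈ vertices
    s₂∈ 2≤i i≤b = afterβ (there
      (∈-++⁺ʳ (map (λ i → s i 1) [ 1 ⋯ b ]) (∈-++⁺ˡ (∈-map⁺ (λ i → s i 2) (∈-range⁺ 2≤i i≤b)))))

    s₃∈ : ∀ {i} → 2 ≤ i → i ≤ b → s i 3 ∈ vertices
    s₃∈ 2≤i i≤b = afterβ (there
      (∈-++⁺ʳ (map (λ i → s i 1) [ 1 ⋯ b ]) (∈-++⁺ʳ (map (λ i → s i 2) [ 2 ⋯ b ])
        (∈-++⁺ˡ (∈-map⁺ (λ i → s i 3) (∈-range⁺ 2≤i i≤b))))))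

    i≤b⇒i-1≤b : ∀ {i} → i ≤ b → i ∸ 1 ≤ b
    i≤b⇒i-1≤b {i} = ℕ.≤-trans (ℕ.m∸n≤m i 1)

    1≤b : 1 ≤ b
    1≤b = ℕ.≤-trans (ℕ.n≤1+n 1) b≥2

    cross-bound : ∀ {i} → 1 ≤ i → 1 + 3 * (b ∸ i) ≤ 3 * b ∸ 2
    cross-bound {i} 1≤i = begin
      1 + 3 * (b ∸ i)       ≤⟨ ℕ.+-monoʳ-≤ 1 (ℕ.*-monoʳ-≤ 3 (ℕ.∸-monoʳ-≤ b 1≤i)) ⟩
      1 + 3 * (b ∸ 1)       ≡⟨ ℕ.m+n∸m≡n 2 (1 + 3 * (b ∸ 1)) ⟨
      3 + 3 * (b ∸ 1) ∸ 2   ≡⟨ cong (_∸ 2) (ℕ.*-suc 3 (b ∸ 1)) ⟨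
      3 * suc (b ∸ 1) ∸ 2   ≡⟨ cong (λ n → 3 * n ∸ 2) (ℕ.m+[n∸m]≡n 1≤b) ⟩
      3 * b ∸ 2             ∎
      where open ℕ.≤-Reasoning

    EndsIn : Edge → Set
    EndsIn e = proj₁ (ends e) ∈ vertices × proj₂ (ends e) ∈ vertices

    inRange : ∀ {m n} (c : ℕ → Edge) → (∀ {i} → m ≤ i → i ≤ n → EndsIn (c i)) →
              All EndsIn (map c [ m ⋯ n ])
    inRange c h = All.map⁺ (All.tabulate (λ i∈ → h (proj₁ (∈-range⁻ i∈)) (proj₂ (∈-range⁻ i∈))))

    ends-vertices : All EndsIn edges
    ends-vertices =
      All.++⁺ ((β∈ ℕ.≤-refl 1≤b , β₁′∈)
               ∷ (β∈ ℕ.≤-refl 1≤b , s₁∈ ℕ.≤-refl 1≤b)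
               ∷ (β₁′∈ , s₁∈ ℕ.≤-refl 1≤b) ∷ [])
      (All.++⁺ (inRange ββ  (λ l u → β∈ (ℕ.∸-monoˡ-≤ 1 l) (i≤b⇒i-1≤b u) , β∈ (ℕ.<⇒≤ l) u))
      (All.++⁺ (inRange βs  (λ l u → β∈ (ℕ.<⇒≤ l) u , s₁∈ (ℕ.<⇒≤ l) u))
      (All.++⁺ (inRange ss₁ (λ l u → s₁∈ (ℕ.<⇒≤ l) u , s₂∈ l u))
      (All.++⁺ (inRange ss₂ (λ l u → s₂∈ l u , s₃∈ l u))
      (All.++⁺ (inRange ss₃ (λ l u → s₃∈ l u , s₁∈ (ℕ.∸-monoˡ-≤ 1 l) (i≤b⇒i-1≤b u)))
      (All.++⁺ (All.map⁺ (All.applyUpTo⁺₁ (λ k → k) (3 * b ∸ 2) (λ k< → p∈ (ℕ.<⇒≤ k<) , p∈ k<)))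
      (All.++⁺ (inRange cross (λ l u → β∈ l u , p∈ (cross-bound l))) [])))))))

  graph : Graph
  graph = record
    { Vertex          = Vertex
    ; Edge            = Edge
    ; _≟ⱽ_            = _≟ⱽ_
    ; _≟ᴱ_            = _≟ᴱ_
    ; vertices        = vertices
    ; edges           = edges
    ; ends            = ends
    ; vertices-unique = vertices-unique
    ; edges-unique    = edges-unique
    ; ends-vertices   = ends-vertices
    }

  deficiency : Vertex → ℕ
  deficiency v = indicator (does (v ≟ⱽ p 0) ∨ does (v ≟ⱽ β b))

  f : Vertex → ℕ
  f v = Degree.degree graph M v + deficiency v

  open Graph graph public using (order; size)
  open Matching graph f M public

  -- Index 0 is not used; B 1 is the triangle.
  B : ℕ → Node
  B (suc i@(suc _)) =
    blossom (atom (β (suc i)))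
            (B i ∷ atom (s (suc i) 3) ∷ atom (s (suc i) 2) ∷ atom (s (suc i) 1) ∷ [])
            (ββ (suc i) ∷ ss₃ (suc i) ∷ ss₂ (suc i) ∷ ss₁ (suc i) ∷ βs (suc i) ∷ [])
  B _ = blossom (atom (β 1)) (atom β₁′ ∷ atom (s₄ 2) ∷ []) (β₁β₁′ ∷ β₁′s₂₄ ∷ β₁s₂₄ ∷ [])

  -- For i = b this is not an edge of the graph: it is the artificial
  -- base edge, matched because b + 1 is odd, to the artificial vertex
  -- β_{b+1}.
  baseEdge : ℕ → Edge
  baseEdge i = ββ (suc i)

  -- In the search for sats every B i has a positive dual value.
  positive : List (Node × Edge)
  positive = map (λ i → B i , baseEdge i) [ 1 ⋯ b ]

  -- The recursion drops s_{i4}, which is the first vertex of S (i - 1).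
  S : ℕ → List Vertex
  S zero            = []
  S (suc zero)      = s₄ 2 ∷ []
  S (suc i@(suc _)) = s (suc i) 1 ∷ s (suc i) 2 ∷ s (suc i) 3 ∷ S i

  T : ℕ → List Vertex
  T i = map β (reverse [ i ⋯ b ]) ++ S i ++ [ β₁′ ] ++ map β [ 1 ⋯ i ]
        ++ map p (downFrom (2 + 3 * (b ∸ i)))

{-# OPTIONS --safe #-}

-- Put weights Y on the vertices.  Along an alternating trail that starts and ends in
-- unmatched edges, the sum of ±(Y u + Y v) over its edges uv, with sign + for unmatched
-- edges, telescopes to the sum of Y over the two ends.  For the indicator function of a
-- vertex this is the change of its degree under augmentation; in particular an augmenting
-- trail joins p₀ to β_b or returns to p₀.  For a suitable potential it says that
-- 2 len A + 4 · #{i : β_{i-1}β_i ∈ A} ≥ 12 b - 2, and as A uses each of these b - 1 edges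
-- at most once, len A ≥ 4 b + 1.  The trails T_i attain this bound.
--
-- The level b + 2 i + j - 1 of β_j on T_i increases with i, and for i = j it is already
-- attained by a trail to β_j with the same last M-type; the descent from β_b gives a short
-- trail of the other type.  Hence each j < i yields a petalevel, which makes Θ(b²) of them,
-- since there are Θ(b) vertices and sats have Θ(b) levels.
module Submission where

open import Defs
open import Data.Bool.Base as Bool using (Bool; true; false; not; if_then_else_; _∨_; _xor_)
open import Data.Bool.Properties as Bool using (not-¬; ¬-not; not-involutive; T?)
open import Data.Integer.Base as ℤ using (ℤ; -_; 0ℤ)
import Data.Integer.Properties as ℤ
open import Data.Integer.Tactic.RingSolver using (solve-∀)
open import Data.List.Base using (List; []; _∷_; _++_; map; drop; last; length; filterᵇ; upTo;
  applyUpTo; applyDownFrom; downFrom; reverse; cartesianProduct)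
import Data.List.Membership.DecPropositional as DecMembership
open import Data.List.Membership.Propositional using (_∈_; _∉_)
open import Data.List.Membership.Propositional.Properties
import Data.List.Properties as List
open import Data.List.Relation.Binary.Permutation.Propositional.Properties using (shift; ∈-resp-↭; ↭-length)
open import Data.List.Relation.Unary.All as All using (All; []; _∷_)
import Data.List.Relation.Unary.All.Properties as All
open import Data.List.Relation.Unary.AllPairs as AllPairs using ([]; _∷_)
open import Data.List.Relation.Unary.Any using (here; there)
open import Data.List.Relation.Unary.Linked as Linked using (Linked; [-]; _∷_)
open import Data.List.Relation.Unary.Linked.Properties using (Linked⇒AllPairs)
open import Data.List.Relation.Unary.Unique.Propositional using (Unique)
import Data.List.Relation.Unary.Unique.Propositional.Properties as Unique
open import Data.Maybe.Base as Maybe using (maybe′)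
import Data.Maybe.Relation.Unary.All as MaybeAll
open import Data.Maybe.Relation.Unary.Any as MaybeAny using (just)
open import Data.Nat.Base using (ℕ; zero; suc; _+_; _*_; _∸_; _≤_; _<_; z≤n; s≤s)
open import Data.Nat.Divisibility using (_∣_; divides)
open import Data.Nat.ListAction using (sum)
import Data.Nat.Properties as ℕ
import Data.Nat.Tactic.RingSolver as ℕ-Solver
open import Data.Product.Base using (∃-syntax; _×_; _,_; proj₁; proj₂)
open import Data.Product.Relation.Binary.Lex.Strict using (×-Lex; ×-transitive)
open import Data.Sum.Base using (_⊎_; inj₁; inj₂)
open import Function.Base using (_∘_; flip)
open import Relation.Binary.Definitions using (DecidableEquality; Transitive)
open import Relation.Binary.PropositionalEquality using (_≡_; _≢_; refl; sym; trans; cong; cong₂; subst; subst₂;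
  resp₂; isEquivalence; module ≡-Reasoning)
open import Relation.Nullary.Decidable using (Dec; does; yes; no; dec-true; dec-false)
open import Relation.Nullary.Negation using (¬_; contradiction)

-- Lists and numbers

lastFrom : {A : Set} → A → List A → A
lastFrom x []       = x
lastFrom x (y ∷ ys) = lastFrom y ys

last-∷ : {A : Set} (x : A) (xs : List A) → last (x ∷ xs) ≡ Maybe.just (lastFrom x xs)
last-∷ x []       = refl
last-∷ x (y ∷ ys) = last-∷ y ys

at-prefix : {A : Set} (xs : List A) {u : A} {ys : List A} → (xs ++ u ∷ ys) at length xs is u
at-prefix []       = refl
at-prefix (x ∷ xs) = at-prefix xs

-- Covers the positions strictly after `u` up to the end of `ys`. With `Q` as membership in a
-- blossom it shows that a trail, once inside, stays there until the level in question.
at-tail : {A : Set} {Q : A → Set} (xs : List A) {u : A} {ys zs : List A} → All Q ys →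
          ∀ {m w} → length xs < m → m ≤ length xs + length ys → (xs ++ u ∷ ys ++ zs) at m is w → Q w
at-tail (x ∷ xs) qs {suc m} (s≤s l<m) (s≤s m≤) at = at-tail xs qs l<m m≤ at
at-tail []       (q ∷ qs) {suc zero}    _ _        refl = q
at-tail []       {u} (_∷_ {x = y} q qs) {suc (suc m)} _ (s≤s m≤) at = at-tail [] {y} qs (s≤s z≤n) m≤ at

at⇒∈ : {A : Set} (xs : List A) (k : ℕ) {x : A} → xs at k is x → x ∈ xs × k < length xs
at⇒∈ []       zero    ()
at⇒∈ []       (suc k) ()
at⇒∈ (y ∷ ys) zero    refl = here refl , s≤s z≤n
at⇒∈ (y ∷ ys) (suc k) at with at⇒∈ ys k at
... | x∈ , k< = there x∈ , s≤s k<

-- Pigeonhole without decidable equality: the head of `xs` is cut out of `ys` at some occurrence,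
-- and by uniqueness the tail of `xs` still fits into what remains.
unique-⊆-length : {A : Set} {xs : List A} → Unique xs → (ys : List A) → (∀ {x} → x ∈ xs → x ∈ ys) →
                  length xs ≤ length ys
unique-⊆-length [] ys xs⊆ys = z≤n
unique-⊆-length {xs = x ∷ xs} u@(_ ∷ uxs) ys xs⊆ys with ∈-∃++ (xs⊆ys (here refl))
... | ys₁ , ys₂ , refl = ℕ.≤-trans
  (s≤s (unique-⊆-length uxs (ys₁ ++ ys₂) xs⊆))
  (ℕ.≤-reflexive (sym (↭-length (shift x ys₁ ys₂))))
  where
  xs⊆ : ∀ {z} → z ∈ xs → z ∈ ys₁ ++ ys₂
  xs⊆ z∈ with ∈-resp-↭ (shift x ys₁ ys₂) (xs⊆ys (there z∈))
  ... | here refl = contradiction z∈ (Unique.Unique[x∷xs]⇒x∉xs u)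
  ... | there z∈′ = z∈′

range-empty : ∀ n → [ suc n ⋯ n ] ≡ []
range-empty n = cong (applyUpTo (suc n +_)) (ℕ.n∸n≡0 n)

applyUpTo-cong : {A : Set} {g h : ℕ → A} → (∀ k → g k ≡ h k) → ∀ n → applyUpTo g n ≡ applyUpTo h n
applyUpTo-cong eq zero    = refl
applyUpTo-cong eq (suc n) = cong₂ _∷_ (eq 0) (applyUpTo-cong (eq ∘ suc) n)

range-∷ : ∀ {m n} → m ≤ n → [ m ⋯ n ] ≡ m ∷ [ suc m ⋯ n ]
range-∷ {m} {n} m≤n = trans (cong (applyUpTo (m +_)) (ℕ.+-∸-assoc 1 m≤n))
  (cong₂ _∷_ (ℕ.+-identityʳ m) (applyUpTo-cong (ℕ.+-suc m) (n ∸ m)))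

range-single : ∀ n → [ n ⋯ n ] ≡ n ∷ []
range-single n = trans (range-∷ (ℕ.≤-refl {n})) (cong (n ∷_) (range-empty n))

length-range : ∀ m n → length [ m ⋯ n ] ≡ suc n ∸ m
length-range m n = List.length-applyUpTo (m +_) (suc n ∸ m)

reverse-range : ∀ m n → reverse [ m ⋯ m + n ] ≡ (m + n) ∷ applyDownFrom (m +_) n
reverse-range m n = trans (List.reverse-applyUpTo (m +_) (suc (m + n) ∸ m))
  (cong (applyDownFrom (m +_)) (trans (cong (_∸ m) (sym (ℕ.+-suc m n))) (ℕ.m+n∸m≡n m (suc n))))

applyUpTo-++ : {A : Set} (g : ℕ → A) (m n : ℕ) → applyUpTo g m ++ applyUpTo (λ k → g (m + k)) n ≡ applyUpTo g (m + n)
applyUpTo-++ g zero    n = refl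
applyUpTo-++ g (suc m) n = cong (g 0 ∷_) (applyUpTo-++ (g ∘ suc) m n)

range-++ : ∀ {m n} → m ≤ n → [ 1 ⋯ m ] ++ [ suc m ⋯ n ] ≡ [ 1 ⋯ n ]
range-++ {m} {n} m≤n = trans (applyUpTo-++ suc m (n ∸ m)) (cong (applyUpTo suc) (ℕ.m+[n∸m]≡n m≤n))

length-cartesianProduct : {A B : Set} (xs : List A) (ys : List B) →
                          length (cartesianProduct xs ys) ≡ length xs * length ys
length-cartesianProduct []       ys = refl
length-cartesianProduct (x ∷ xs) ys = trans (List.length-++ (map (x ,_) ys))
  (cong₂ _+_ (List.length-map (x ,_) ys) (length-cartesianProduct xs ys))

-- Lexicographic order for comparing ranks of edges: the first component names a stage of the trail,
-- the second a position within that stage.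
_≺_ : ℕ × ℕ → ℕ × ℕ → Set
_≺_ = ×-Lex _≡_ _<_ _<_

≺-trans : Transitive _≺_
≺-trans = ×-transitive {_<₁_ = _<_} {_<₂_ = _<_} isEquivalence (resp₂ _<_) ℕ.<-trans ℕ.<-trans

≺-irrefl : ∀ {x} → ¬ (x ≺ x)
≺-irrefl (inj₁ lt)       = ℕ.<-irrefl refl lt
≺-irrefl (inj₂ (_ , lt)) = ℕ.<-irrefl refl lt

odd-+ : ∀ m n → odd (m + n) ≡ odd m xor odd n
odd-+ zero    n = refl
odd-+ (suc m) n = trans (cong not (odd-+ m n)) (not-xor (odd m))
  where
  not-xor : ∀ c {d} → not (c xor d) ≡ not c xor d
  not-xor true  = not-involutive _
  not-xor false = refl

odd-3* : ∀ n → odd (3 * n) ≡ odd n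
odd-3* n = trans (odd-+ n (n + (n + 0))) (trans (cong (odd n xor_) (trans (odd-+ n (n + 0))
  (cong (λ m → odd n xor odd m) (ℕ.+-identityʳ n)))) (xor-self (odd n)))
  where
  xor-self : ∀ c → c xor (c xor c) ≡ c
  xor-self true  = refl
  xor-self false = refl

odd-*2 : ∀ n → odd (n * 2) ≡ false
odd-*2 zero    = refl
odd-*2 (suc n) = cong (not ∘ not) (odd-*2 n)

-- Sums of integers

Σℤ : {A : Set} → (A → ℤ) → List A → ℤ
Σℤ g []       = 0ℤ
Σℤ g (x ∷ xs) = g x ℤ.+ Σℤ g xs

Σℤ-cong : {A : Set} {g h : A → ℤ} → (∀ x → g x ≡ h x) → ∀ xs → Σℤ g xs ≡ Σℤ h xs
Σℤ-cong eq []       = refl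
Σℤ-cong eq (x ∷ xs) = cong₂ ℤ._+_ (eq x) (Σℤ-cong eq xs)

Σℤ-0 : {A : Set} (xs : List A) → Σℤ (λ _ → 0ℤ) xs ≡ 0ℤ
Σℤ-0 []       = refl
Σℤ-0 (x ∷ xs) = trans (ℤ.+-identityˡ _) (Σℤ-0 xs)

Σℤ-+ : {A : Set} (g h : A → ℤ) (xs : List A) → Σℤ (λ x → g x ℤ.+ h x) xs ≡ Σℤ g xs ℤ.+ Σℤ h xs
Σℤ-+ g h []       = refl
Σℤ-+ g h (x ∷ xs) = trans (cong (ℤ._+_ (g x ℤ.+ h x)) (Σℤ-+ g h xs)) (interchange (g x) (h x) _ _)
  where
  interchange : ∀ a b c d → a ℤ.+ b ℤ.+ (c ℤ.+ d) ≡ a ℤ.+ c ℤ.+ (b ℤ.+ d)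
  interchange = solve-∀

module _ {A : Set} (_≟_ : DecidableEquality A) where
  open DecMembership _≟_ using (_∈?_)

  Σℤ-single : (g : A → ℤ) {x : A} (ys : List A) → Unique ys → x ∈ ys →
              Σℤ (λ y → if does (y ≟ x) then g y else 0ℤ) ys ≡ g x
  Σℤ-single g {x} (y ∷ ys) u@(_ ∷ uys) x∈ with y ≟ x | x∈
  ... | no y≢x   | here refl = contradiction refl y≢x
  ... | no _     | there x∈′ = trans (ℤ.+-identityˡ _) (Σℤ-single g ys uys x∈′)
  ... | yes refl | _         = trans (cong (ℤ._+_ (g x)) (vanish ys (Unique.Unique[x∷xs]⇒x∉xs u))) (ℤ.+-identityʳ _)
    where
    vanish : ∀ zs → x ∉ zs → Σℤ (λ y → if does (y ≟ x) then g y else 0ℤ) zs ≡ 0ℤ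
    vanish []       _    = refl
    vanish (z ∷ zs) x∉ with z ≟ x
    ... | yes refl = contradiction (here refl) x∉
    ... | no _     = trans (ℤ.+-identityˡ _) (vanish zs (x∉ ∘ there))

  -- Turns a sum over all edges, restricted by an indicator to those on a trail, into a sum along
  -- the trail. Uniqueness of both lists makes each edge of the trail count once on either side.
  Σℤ-restrict : (g : A → ℤ) {xs ys : List A} → Unique ys → Unique xs → All (_∈ ys) xs →
                Σℤ (λ y → if does (y ∈? xs) then g y else 0ℤ) ys ≡ Σℤ g xs
  Σℤ-restrict g {[]}     {ys} _   _            _         = Σℤ-0 ys
  Σℤ-restrict g {x ∷ xs} {ys} uys u@(_ ∷ uxs) (x∈ ∷ xs∈) = begin
    Σℤ (λ y → if does (y ∈? (x ∷ xs)) then g y else 0ℤ) ys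
      ≡⟨ Σℤ-cong split ys ⟩
    Σℤ (λ y → (if does (y ≟ x) then g y else 0ℤ) ℤ.+ (if does (y ∈? xs) then g y else 0ℤ)) ys
      ≡⟨ Σℤ-+ _ _ ys ⟩
    Σℤ (λ y → if does (y ≟ x) then g y else 0ℤ) ys ℤ.+ Σℤ (λ y → if does (y ∈? xs) then g y else 0ℤ) ys
      ≡⟨ cong₂ ℤ._+_ (Σℤ-single g ys uys x∈) (Σℤ-restrict g uys uxs xs∈) ⟩
    g x ℤ.+ Σℤ g xs ∎
    where
    open ≡-Reasoning
    split : ∀ y → (if does (y ∈? (x ∷ xs)) then g y else 0ℤ)
                ≡ (if does (y ≟ x) then g y else 0ℤ) ℤ.+ (if does (y ∈? xs) then g y else 0ℤ)
    split y with y ≟ x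
    ... | no _     = sym (ℤ.+-identityˡ _)
    ... | yes refl = sym (trans (cong (λ c → g x ℤ.+ (if c then g x else 0ℤ))
                                      (dec-false (x ∈? xs) (Unique.Unique[x∷xs]⇒x∉xs u)))
                                (ℤ.+-identityʳ _))

-- Signs given by M-types

signed : Bool → ℤ → ℤ
signed c z = if c then - z else z

signed-cancel : ∀ {c d} → c ≢ d → ∀ x y → signed c (x ℤ.+ y) ℤ.+ signed d y ≡ signed c x
signed-cancel {false} {false} c≢d x y = contradiction refl c≢d
signed-cancel {true}  {true}  c≢d x y = contradiction refl c≢d
signed-cancel {false} {true}  _ = cancel
  where
  cancel : ∀ x y → x ℤ.+ y ℤ.+ - y ≡ x
  cancel = solve-∀
signed-cancel {true}  {false} _ = cancel
  where
  cancel : ∀ x y → - (x ℤ.+ y) ℤ.+ y ≡ - x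
  cancel = solve-∀

-- This and the next three identities are the sign patterns met in `potential-edge`: the ends have
-- equal or opposite signs, and the edge agrees with one of them or with neither.
signed-same : ∀ c x y → signed c (signed c x ℤ.+ signed c y) ≡ x ℤ.+ y
signed-same false x y = refl
signed-same true      = identity
  where
  identity : ∀ x y → - (- x ℤ.+ - y) ≡ x ℤ.+ y
  identity = solve-∀

signed-not : ∀ c x y → signed (not c) (signed c x ℤ.+ signed c y) ≡ - (x ℤ.+ y)
signed-not false x y = refl
signed-not true      = identity
  where
  identity : ∀ x y → - x ℤ.+ - y ≡ - (x ℤ.+ y)
  identity = solve-∀

signed-flipˡ : ∀ c x y → signed c (signed (not c) x ℤ.+ signed c y) ≡ y ℤ.- x
signed-flipˡ false = identity
  where
  identity : ∀ x y → - x ℤ.+ y ≡ y ℤ.- x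
  identity = solve-∀
signed-flipˡ true  = identity
  where
  identity : ∀ x y → - (x ℤ.+ - y) ≡ y ℤ.- x
  identity = solve-∀

signed-flipʳ : ∀ c x y → signed (not c) (signed c x ℤ.+ signed (not c) y) ≡ y ℤ.- x
signed-flipʳ false = identity
  where
  identity : ∀ x y → - (x ℤ.+ - y) ≡ y ℤ.- x
  identity = solve-∀
signed-flipʳ true  = identity
  where
  identity : ∀ x y → - x ℤ.+ y ≡ y ℤ.- x
  identity = solve-∀

-- Alternating trails in a graph

module Trails (G : Graph) (f : Graph.Vertex G → ℕ) (M : Graph.Edge G → Bool) where
  open Graph G renaming (Vertex to V; Edge to E; _≟ⱽ_ to _≟V_; _≟ᴱ_ to _≟E_)
  open Matching G f M
  open DecMembership _≟E_ using (_∈?_)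
  open import Data.Integer.Base using (+_)

  private variable
    x y : V
    xs  : List V
    e   : E
    es  : List E

  Σℤ-sum : {A : Set} (g : A → ℕ) (xs : List A) → + sum (map g xs) ≡ Σℤ (+_ ∘ g) xs
  Σℤ-sum g []       = refl
  Σℤ-sum g (x ∷ xs) = cong (ℤ._+_ (+ g x)) (Σℤ-sum g xs)

  endSum : (V → ℤ) → E → ℤ
  endSum Y e = Y (proj₁ (ends e)) ℤ.+ Y (proj₂ (ends e))

  endSum-joins : (Y : V → ℤ) → Joins e x y → endSum Y e ≡ Y x ℤ.+ Y y
  endSum-joins Y (inj₁ eq) = cong (λ (u , w) → Y u ℤ.+ Y w) eq
  endSum-joins {x = x} {y} Y (inj₂ eq) = trans (cong (λ (u , w) → Y u ℤ.+ Y w) eq) (ℤ.+-comm (Y y) (Y x))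

  -- Consecutive edges have opposite signs, so the two contributions of every inner visit to a
  -- vertex cancel and only the ends of the walk remain.
  telescope : (Y : V → ℤ) → IsWalk Joins (x ∷ xs) (e ∷ es) →
              Linked (λ e e′ → M e ≢ M e′) (e ∷ es) →
              Σℤ (λ e → signed (M e) (endSum Y e)) (e ∷ es)
                ≡ signed (M e) (Y x) ℤ.+ signed (M (lastFrom e es)) (Y (lastFrom x xs))
  telescope {x} {e = e} Y (step {y = y} _ j single) _ =
    trans (ℤ.+-identityʳ _) (trans (cong (signed (M e)) (endSum-joins Y j)) (distrib (M e)))
    where
    distrib : ∀ c → signed c (Y x ℤ.+ Y y) ≡ signed c (Y x) ℤ.+ signed c (Y y)
    distrib true  = ℤ.neg-distrib-+ (Y x) (Y y)
    distrib false = refl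
  telescope {x} {xs = _ ∷ xs} {e = e} {e′ ∷ es} Y (step {y = y} _ j w@(step _ _ _)) (alt ∷ alts) = begin
    signed (M e) (endSum Y e) ℤ.+ Σℤ (λ e → signed (M e) (endSum Y e)) (e′ ∷ es)
      ≡⟨ cong₂ ℤ._+_ (cong (signed (M e)) (endSum-joins Y j)) (telescope Y w alts) ⟩
    signed (M e) (Y x ℤ.+ Y y) ℤ.+ (signed (M e′) (Y y) ℤ.+ z)
      ≡⟨ ℤ.+-assoc (signed (M e) (Y x ℤ.+ Y y)) (signed (M e′) (Y y)) z ⟨
    signed (M e) (Y x ℤ.+ Y y) ℤ.+ signed (M e′) (Y y) ℤ.+ z
      ≡⟨ cong (λ i → i ℤ.+ z) (signed-cancel alt (Y x) (Y y)) ⟩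
    signed (M e) (Y x) ℤ.+ z ∎
    where
    open ≡-Reasoning
    z = signed (M (lastFrom e′ es)) (Y (lastFrom y xs))

  walk-edges : IsWalk Joins xs es → All (_∈ edges) es
  walk-edges single        = []
  walk-edges (step e∈ _ w) = e∈ ∷ walk-edges w

  walk-vertices : IsWalk Joins (x ∷ xs) es → x ∈ vertices → All (_∈ vertices) (x ∷ xs)
  walk-vertices single x∈ = x∈ ∷ []
  walk-vertices (step e∈ j w) x∈ = x∈ ∷ walk-vertices w (other j (All.lookup ends-vertices e∈))
    where
    other : ∀ {e x y} → Joins e x y → proj₁ (ends e) ∈ vertices × proj₂ (ends e) ∈ vertices → y ∈ vertices
    other (inj₁ eq) (_ , h) = subst (_∈ vertices) (cong proj₂ eq) h
    other (inj₂ eq) (h , _) = subst (_∈ vertices) (cong proj₁ eq) h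

  walk-length : IsWalk Joins xs es → length xs ≡ suc (length es)
  walk-length single       = refl
  walk-length (step _ _ w) = cong suc (walk-length w)

  -- Transfers a splitting of the vertex sequence to the edges. It locates the cross edge of T_i and
  -- the petals on which T_i enters blossoms.
  walk-edge : ∀ xs {u w ys es} → IsWalk Joins (xs ++ u ∷ w ∷ ys) es →
              ∃[ e ] es at length xs is e × Joins e u w × e ∈ edges
  walk-edge []           (step e∈ j _) = _ , refl , j , e∈
  walk-edge (x ∷ [])     (step _ _ w)  = walk-edge [] w
  walk-edge (x ∷ y ∷ xs) (step _ _ w)  = walk-edge (y ∷ xs) w

  δ : V → V → ℕ
  δ v x = indicator (does (x ≟V v))

  -- This is `telescope` for the indicator of `v`. The two ends are counted separately, so a trail
  -- that returns to its start raises the degree there by 2.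
  degree-⊕ : (A : Trail) → verts A ≡ x ∷ xs → route A ≡ e ∷ es → Alternating A →
             M e ≡ unmatched → M (lastFrom e es) ≡ unmatched → ∀ v →
             degree (M ⊕ A) v ≡ degree M v + (δ v x + δ v (lastFrom x xs))
  degree-⊕ {x} {xs} {e} {es} A refl refl alt first-u last-u v = ℤ.+-injective (begin
    + degree (M ⊕ A) v
      ≡⟨ Σℤ-sum _ edges ⟩
    Σℤ (λ e → + (if (M ⊕ A) e then ε e else 0)) edges
      ≡⟨ Σℤ-cong toggled edges ⟩
    Σℤ (λ e → + (if M e then ε e else 0) ℤ.+ (if does (e ∈? route A) then g e else 0ℤ)) edges
      ≡⟨ Σℤ-+ _ _ edges ⟩
    Σℤ (λ e → + (if M e then ε e else 0)) edges
      ℤ.+ Σℤ (λ e → if does (e ∈? route A) then g e else 0ℤ) edges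
      ≡⟨ cong₂ ℤ._+_ (sym (Σℤ-sum _ edges))
                     (Σℤ-restrict _≟E_ g edges-unique (distinct A) (walk-edges (isWalk A))) ⟩
    + degree M v ℤ.+ Σℤ g (route A)
      ≡⟨ cong (ℤ._+_ (+ degree M v)) (telescope (+_ ∘ δ v) (isWalk A) alt) ⟩
    + degree M v ℤ.+ (signed (M e) (+ δ v x) ℤ.+ signed (M (lastFrom e es)) (+ δ v (lastFrom x xs)))
      ≡⟨ cong₂ (λ c d → + degree M v ℤ.+ (signed c (+ δ v x) ℤ.+ signed d (+ δ v (lastFrom x xs))))
               first-u last-u ⟩
    + (degree M v + (δ v x + δ v (lastFrom x xs))) ∎)
    where
    open ≡-Reasoning
    ε : E → ℕ
    ε e = δ v (proj₁ (ends e)) + δ v (proj₂ (ends e))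
    g : E → ℤ
    g e = signed (M e) (endSum (+_ ∘ δ v) e)
    -- Flipping an unmatched edge adds its contribution and flipping a matched one removes it, which
    -- is what the sign records.
    toggle : ∀ c d n → + (if c xor d then n else 0)
                     ≡ + (if c then n else 0) ℤ.+ (if d then signed c (+ n) else 0ℤ)
    toggle false false n = refl
    toggle false true  n = refl
    toggle true  false n = sym (ℤ.+-identityʳ (+ n))
    toggle true  true  n = sym (ℤ.+-inverseʳ (+ n))
    toggled : ∀ e → + (if (M ⊕ A) e then ε e else 0)
               ≡ + (if M e then ε e else 0) ℤ.+ (if does (e ∈? route A) then g e else 0ℤ)
    toggled e = toggle (M e) (does (e ∈? route A)) (ε e)

-- The graph EG(b)

module Potential (b : ℕ) (b≥2 : 2 ≤ b) (b-even : odd b ≡ false) where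
  open EG b b≥2
  open Graph graph using (vertices; edges; ends-vertices)
  open Trails graph f M public
  open import Data.Integer.Base using (+_)

  -- Edge names exist for all indices. Matching on this family restricts them to the graph and
  -- yields the bounds on the index.
  data IsEdge : Edge → Set where
    β₁β₁′  : IsEdge β₁β₁′
    β₁s₂₄  : IsEdge β₁s₂₄
    β₁′s₂₄ : IsEdge β₁′s₂₄
    ββ     : ∀ {i} → 2 ≤ i → i ≤ b → IsEdge (ββ i)
    βs     : ∀ {i} → 2 ≤ i → i ≤ b → IsEdge (βs i)
    ss₁    : ∀ {i} → 2 ≤ i → i ≤ b → IsEdge (ss₁ i)
    ss₂    : ∀ {i} → 2 ≤ i → i ≤ b → IsEdge (ss₂ i)
    ss₃    : ∀ {i} → 2 ≤ i → i ≤ b → IsEdge (ss₃ i)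
    pp     : ∀ {k} → k < 3 * b ∸ 2 → IsEdge (pp k)
    cross  : ∀ {i} → 1 ≤ i → i ≤ b → IsEdge (cross i)

  ∈-edges⁻ : ∀ {e} → e ∈ edges → IsEdge e
  ∈-edges⁻ = All.lookup
    (All.++⁺ (β₁β₁′ ∷ β₁s₂₄ ∷ β₁′s₂₄ ∷ [])
    (All.++⁺ (family ββ) (All.++⁺ (family βs)
    (All.++⁺ (family ss₁) (All.++⁺ (family ss₂) (All.++⁺ (family ss₃)
    (All.++⁺ (All.map⁺ (All.applyUpTo⁺₁ (λ k → k) (3 * b ∸ 2) pp))
    (All.++⁺ (family cross) []))))))))
    where
    family : ∀ {m n} {c : ℕ → Edge} → (∀ {i} → m ≤ i → i ≤ n → IsEdge (c i)) → All IsEdge (map c [ m ⋯ n ])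
    family h = All.map⁺ (All.tabulate (λ i∈ → h (proj₁ (∈-range⁻ i∈)) (proj₂ (∈-range⁻ i∈))))

  ∈-edges⁺ : ∀ {e} → IsEdge e → e ∈ edges
  ∈-edges⁺ β₁β₁′       = here refl
  ∈-edges⁺ β₁s₂₄       = there (here refl)
  ∈-edges⁺ β₁′s₂₄      = there (there (here refl))
  ∈-edges⁺ (ββ l u)    = there (there (there (∈-++⁺ˡ (∈-map⁺ ββ (∈-range⁺ l u)))))
  ∈-edges⁺ (βs l u)    = there (there (there (∈-++⁺ʳ (map ββ [ 2 ⋯ b ])
    (∈-++⁺ˡ (∈-map⁺ βs (∈-range⁺ l u))))))
  ∈-edges⁺ (ss₁ l u)   = there (there (there (∈-++⁺ʳ (map ββ [ 2 ⋯ b ]) (∈-++⁺ʳ (map βs [ 2 ⋯ b ])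
    (∈-++⁺ˡ (∈-map⁺ ss₁ (∈-range⁺ l u)))))))
  ∈-edges⁺ (ss₂ l u)   = there (there (there (∈-++⁺ʳ (map ββ [ 2 ⋯ b ]) (∈-++⁺ʳ (map βs [ 2 ⋯ b ])
    (∈-++⁺ʳ (map ss₁ [ 2 ⋯ b ]) (∈-++⁺ˡ (∈-map⁺ ss₂ (∈-range⁺ l u))))))))
  ∈-edges⁺ (ss₃ l u)   = there (there (there (∈-++⁺ʳ (map ββ [ 2 ⋯ b ]) (∈-++⁺ʳ (map βs [ 2 ⋯ b ])
    (∈-++⁺ʳ (map ss₁ [ 2 ⋯ b ]) (∈-++⁺ʳ (map ss₂ [ 2 ⋯ b ])
    (∈-++⁺ˡ (∈-map⁺ ss₃ (∈-range⁺ l u)))))))))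
  ∈-edges⁺ (pp k<)     = there (there (there (∈-++⁺ʳ (map ββ [ 2 ⋯ b ]) (∈-++⁺ʳ (map βs [ 2 ⋯ b ])
    (∈-++⁺ʳ (map ss₁ [ 2 ⋯ b ]) (∈-++⁺ʳ (map ss₂ [ 2 ⋯ b ]) (∈-++⁺ʳ (map ss₃ [ 2 ⋯ b ])
    (∈-++⁺ˡ (∈-map⁺ pp (∈-upTo⁺ k<))))))))))
  ∈-edges⁺ (cross l u) = there (there (there (∈-++⁺ʳ (map ββ [ 2 ⋯ b ]) (∈-++⁺ʳ (map βs [ 2 ⋯ b ])
    (∈-++⁺ʳ (map ss₁ [ 2 ⋯ b ]) (∈-++⁺ʳ (map ss₂ [ 2 ⋯ b ]) (∈-++⁺ʳ (map ss₃ [ 2 ⋯ b ])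
    (∈-++⁺ʳ (map pp (upTo (3 * b ∸ 2))) (∈-++⁺ˡ (∈-map⁺ cross (∈-range⁺ l u)))))))))))

  -- As b is even, b - i and i have the same parity, and tripling keeps it. Hence the cross edge at
  -- β_i alternates with the path edge that follows it towards p₀.
  odd-complement : ∀ {i} → i ≤ b → odd (3 * (b ∸ i)) ≡ odd i
  odd-complement {i} i≤b = trans (odd-3* (b ∸ i)) (xor-false (odd (b ∸ i)) (odd i)
    (trans (sym (odd-+ (b ∸ i) i)) (trans (cong odd (ℕ.m∸n+n≡m i≤b)) b-even)))
    where
    xor-false : ∀ c d → c xor d ≡ false → c ≡ d
    xor-false true  true  _ = refl
    xor-false false false _ = refl

  -- Determined by the equations of potential-edge.  The value 6 instead of 2 at ββ i
  -- reflects that a trail using ββ i may pass level i with four edges, and otherwise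
  -- needs six.
  potential : Vertex → ℤ
  potential (β i)   = signed (odd i) (+ 6 ℤ.* + i ℤ.- + 3)
  potential β₁′     = + 1
  potential (s i 1) = signed (odd i) (+ 5 ℤ.- + 6 ℤ.* + i)
  potential (s i 2) = signed (odd i) (+ 6 ℤ.* + i ℤ.- + 7)
  potential (s i j) = signed (odd i) (+ 9 ℤ.- + 6 ℤ.* + i)
  potential (p k)   = signed (odd k) (+ 6 ℤ.* + b ℤ.+ + 1 ℤ.- + 2 ℤ.* + k)

  isββ : Edge → Bool
  isββ (ββ _) = true
  isββ _      = false

  cost : Edge → ℤ
  cost e = if isββ e then + 6 else + 2

  potential-edge : ∀ {e} → IsEdge e → signed (M e) (endSum potential e) ≡ cost e
  potential-edge β₁β₁′  = refl
  potential-edge β₁s₂₄  = refl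
  potential-edge β₁′s₂₄ = refl
  potential-edge (ββ {suc i} _ _) =
    trans (signed-flipʳ (odd i) (+ 6 ℤ.* + i ℤ.- + 3) (+ 6 ℤ.* + suc i ℤ.- + 3)) (identity (+ i))
    where
    identity : ∀ i → + 6 ℤ.* (+ 1 ℤ.+ i) ℤ.- + 3 ℤ.- (+ 6 ℤ.* i ℤ.- + 3) ≡ + 6
    identity = solve-∀
  potential-edge (βs {i} _ _) =
    trans (signed-same (odd i) (+ 6 ℤ.* + i ℤ.- + 3) (+ 5 ℤ.- + 6 ℤ.* + i)) (identity (+ i))
    where
    identity : ∀ i → + 6 ℤ.* i ℤ.- + 3 ℤ.+ (+ 5 ℤ.- + 6 ℤ.* i) ≡ + 2
    identity = solve-∀
  potential-edge (ss₁ {i} _ _) =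
    trans (signed-not (odd i) (+ 5 ℤ.- + 6 ℤ.* + i) (+ 6 ℤ.* + i ℤ.- + 7)) (identity (+ i))
    where
    identity : ∀ i → - (+ 5 ℤ.- + 6 ℤ.* i ℤ.+ (+ 6 ℤ.* i ℤ.- + 7)) ≡ + 2
    identity = solve-∀
  potential-edge (ss₂ {i} _ _) =
    trans (signed-same (odd i) (+ 6 ℤ.* + i ℤ.- + 7) (+ 9 ℤ.- + 6 ℤ.* + i)) (identity (+ i))
    where
    identity : ∀ i → + 6 ℤ.* i ℤ.- + 7 ℤ.+ (+ 9 ℤ.- + 6 ℤ.* i) ≡ + 2
    identity = solve-∀
  potential-edge (ss₃ {suc i} _ _) =
    -- The M-type of `ss₃ (suc i)` is a double negation of `odd i`; clearing it matches the sign of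
    -- the edge with the sign at `s i 1`.
    trans (cong (λ c → signed c (signed (not (odd i)) (+ 9 ℤ.- + 6 ℤ.* + suc i)
                                 ℤ.+ signed (odd i) (+ 5 ℤ.- + 6 ℤ.* + i)))
                (not-involutive (odd i)))
    (trans (signed-flipˡ (odd i) (+ 9 ℤ.- + 6 ℤ.* + suc i) (+ 5 ℤ.- + 6 ℤ.* + i)) (identity (+ i)))
    where
    identity : ∀ i → + 5 ℤ.- + 6 ℤ.* i ℤ.- (+ 9 ℤ.- + 6 ℤ.* (+ 1 ℤ.+ i)) ≡ + 2
    identity = solve-∀
  potential-edge (pp {k} _) =
    trans (cong (signed (odd k)) (ℤ.+-comm (signed (odd k) (h (+ k))) (signed (not (odd k)) (h (+ suc k)))))
    (trans (signed-flipˡ (odd k) (h (+ suc k)) (h (+ k))) (identity (+ b) (+ k)))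
    where
    h : ℤ → ℤ
    h k = + 6 ℤ.* + b ℤ.+ + 1 ℤ.- + 2 ℤ.* k
    identity : ∀ b k → + 6 ℤ.* b ℤ.+ + 1 ℤ.- + 2 ℤ.* k
                 ℤ.- (+ 6 ℤ.* b ℤ.+ + 1 ℤ.- + 2 ℤ.* (+ 1 ℤ.+ k)) ≡ + 2
    identity = solve-∀
  potential-edge (cross {i} _ i≤b) = begin
    signed (not c) (signed c x ℤ.+ signed (not (odd (3 * (b ∸ i)))) y)
      ≡⟨ cong (λ c′ → signed (not c) (signed c x ℤ.+ signed (not c′) y)) (odd-complement i≤b) ⟩
    signed (not c) (signed c x ℤ.+ signed (not c) y)
      ≡⟨ signed-flipʳ c x y ⟩
    y ℤ.- x
      -- Writing b as i + (b ∸ i) leaves an identity linear in two independent integers, free of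
      -- truncated subtraction.
      ≡⟨ cong₂ (λ m n → + 6 ℤ.* m ℤ.+ + 1 ℤ.- + 2 ℤ.* (+ 1 ℤ.+ n) ℤ.- x)
               (cong +_ (sym (ℕ.m+[n∸m]≡n i≤b))) (ℤ.pos-* 3 (b ∸ i)) ⟩
    + 6 ℤ.* (+ i ℤ.+ + (b ∸ i)) ℤ.+ + 1 ℤ.- + 2 ℤ.* (+ 1 ℤ.+ + 3 ℤ.* + (b ∸ i)) ℤ.- x
      ≡⟨ identity (+ i) (+ (b ∸ i)) ⟩
    + 2 ∎
    where
    open ≡-Reasoning
    c = odd i
    x = + 6 ℤ.* + i ℤ.- + 3
    y = + 6 ℤ.* + b ℤ.+ + 1 ℤ.- + 2 ℤ.* + (1 + 3 * (b ∸ i))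
    identity : ∀ i d → + 6 ℤ.* (i ℤ.+ d) ℤ.+ + 1 ℤ.- + 2 ℤ.* (+ 1 ℤ.+ + 3 ℤ.* d)
                 ℤ.- (+ 6 ℤ.* i ℤ.- + 3) ≡ + 2
    identity = solve-∀

  -- Every edge costs 2, and an edge `ββ i` costs 4 more.
  len-potential : (es : List Edge) → All (_∈ edges) es →
                  Σℤ (λ e → signed (M e) (endSum potential e)) es
                    ≡ + (2 * length es + 4 * length (filterᵇ isββ es))
  len-potential []       []          = refl
  len-potential (e ∷ es) (e∈ ∷ es∈) = begin
    signed (M e) (endSum potential e) ℤ.+ Σℤ (λ e → signed (M e) (endSum potential e)) es
      ≡⟨ cong₂ ℤ._+_ (potential-edge (∈-edges⁻ e∈)) (len-potential es es∈) ⟩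
    cost e ℤ.+ + (2 * length es + 4 * length (filterᵇ isββ es))
      ≡⟨ add-cost ⟩
    + (2 * suc (length es) + 4 * length (filterᵇ isββ (e ∷ es))) ∎
    where
    open ≡-Reasoning
    add-cost : cost e ℤ.+ + (2 * length es + 4 * length (filterᵇ isββ es))
             ≡ + (2 * suc (length es) + 4 * length (filterᵇ isββ (e ∷ es)))
    add-cost with isββ e
    ... | true  = cong +_ (identity (length es) (length (filterᵇ isββ es)))
      where
      identity : ∀ m n → 6 + (2 * m + 4 * n) ≡ 2 * suc m + 4 * suc n
      identity = ℕ-Solver.solve-∀
    ... | false = cong +_ (identity (length es) (length (filterᵇ isββ es)))
      where
      identity : ∀ m n → 2 + (2 * m + 4 * n) ≡ 2 * suc m + 4 * n
      identity = ℕ-Solver.solve-∀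

  -- A trail repeats no edge, and only b - 1 edges have a name `ββ i`. The form with `suc` avoids
  -- `b ∸ 1`.
  ββ-count : ∀ {es} → Unique es → All (_∈ edges) es → suc (length (filterᵇ isββ es)) ≤ b
  ββ-count {es} ues es∈ = ℕ.≤-trans
    (s≤s (unique-⊆-length (Unique.filter⁺ (T? ∘ isββ) ues) (map ββ [ 2 ⋯ b ]) only-ββ))
    (ℕ.≤-reflexive (trans (cong suc (trans (List.length-map ββ [ 2 ⋯ b ]) (List.length-applyUpTo (_+_ 2) (suc b ∸ 2))))
      (ℕ.m+[n∸m]≡n (ℕ.<⇒≤ b≥2))))
    where
    ββ∈ : ∀ {e} → IsEdge e → Bool.T (isββ e) → e ∈ map ββ [ 2 ⋯ b ]
    ββ∈ (ββ l u) _ = ∈-map⁺ ββ (∈-range⁺ l u)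
    only-ββ : ∀ {e} → e ∈ filterᵇ isββ es → e ∈ map ββ [ 2 ⋯ b ]
    only-ββ e∈ with ∈-filter⁻ (T? ∘ isββ) e∈
    ... | e∈es , t = ββ∈ (∈-edges⁻ (All.lookup es∈ e∈es)) t

  -- Free vertices and the lower bound on the length

  deficient-vertex : ∀ v → 0 < deficiency v → (v ≡ p 0) ⊎ (v ≡ β b)
  deficient-vertex v 0<d with v ≟ⱽ p 0 | v ≟ⱽ β b
  ... | yes eq | _      = inj₁ eq
  ... | no _   | yes eq = inj₂ eq
  ... | no v≢p | no v≢β = contradiction
    (cong₂ (λ c d → indicator (c ∨ d)) (dec-false (v ≟ⱽ p 0) v≢p) (dec-false (v ≟ⱽ β b) v≢β))
    (ℕ.m<n⇒n≢0 0<d)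

  free-vertex : ∀ {v} → Free v → (v ≡ p 0) ⊎ (v ≡ β b)
  free-vertex {v} (_ , deg<f) = deficient-vertex v
    (ℕ.+-cancelˡ-< (degree M v) 0 (deficiency v)
      (subst (_< degree M v + deficiency v) (sym (ℕ.+-identityʳ (degree M v))) deg<f))

  δ-self : ∀ v → δ v v ≡ 1
  δ-self v = cong indicator (dec-true (v ≟ⱽ v) refl)

  deficiency-β : deficiency (β b) ≡ 1
  deficiency-β = cong indicator (dec-true (β b ≟ⱽ β b) refl)

  -- With c at most b - 1 the hypothesis leaves 2 l ≥ 8 b + 2. Adding 4 b to both sides keeps the
  -- computation in the natural numbers.
  len-bound : ∀ {l c} → 12 * b ≤ 2 * l + 4 * c + 2 → suc c ≤ b → 4 * b + 1 ≤ l
  len-bound {l} {c} 12b≤ c<b = ℕ.*-cancelˡ-≤ 2 (ℕ.+-cancelʳ-≤ (4 * b) _ _ (begin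
    2 * (4 * b + 1) + 4 * b    ≡⟨ lhs b ⟩
    12 * b + 2                 ≤⟨ ℕ.+-monoˡ-≤ 2 12b≤ ⟩
    2 * l + 4 * c + 2 + 2      ≡⟨ rhs l c ⟩
    2 * l + 4 * suc c          ≤⟨ ℕ.+-monoʳ-≤ (2 * l) (ℕ.*-monoʳ-≤ 4 c<b) ⟩
    2 * l + 4 * b              ∎))
    where
    open ℕ.≤-Reasoning
    lhs : ∀ b → 2 * (4 * b + 1) + 4 * b ≡ 12 * b + 2
    lhs = ℕ-Solver.solve-∀
    rhs : ∀ l c → 2 * l + 4 * c + 2 + 2 ≡ 2 * l + 4 * suc c
    rhs = ℕ-Solver.solve-∀

  potential-p : potential (p 0) ≡ + (6 * b) ℤ.+ + 1
  potential-p = trans (ℤ.+-identityʳ _) (cong (λ z → z ℤ.+ + 1) (sym (ℤ.pos-* 6 b)))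

  potential-β : potential (β b) ≡ + (6 * b) ℤ.- + 3
  potential-β = trans (cong (λ c → signed c (+ 6 ℤ.* + b ℤ.- + 3)) b-even)
                      (cong (λ z → z ℤ.- + 3) (sym (ℤ.pos-* 6 b)))

  -- A trail from β b back to β b could be shorter; the degree of β b excludes it.
  potential-ends : (A : Trail) → IsAugmenting A →
                   ∃[ c ] suc c ≤ b × 12 * b ≤ 2 * len A + 4 * c + 2
  potential-ends record { route = [] } record { starts-unmatched = () }
  potential-ends A@record { verts = x ∷ xs ; route = e ∷ es ; isWalk = w ; distinct = u } aug
    with just x-free ← IsAugmenting.starts-free aug
       | just z-free ← subst (MaybeAny.Any Free) (last-∷ x xs) (IsAugmenting.ends-free aug)
       | just e-unmatched ← IsAugmenting.starts-unmatched aug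
       | just e′-unmatched ← subst (MaybeAny.Any (λ e → M e ≡ unmatched)) (last-∷ e es) (IsAugmenting.ends-unmatched aug)
    = c , ββ-count u (walk-edges w) , bound (free-vertex x-free) (free-vertex z-free)
    where
    c = length (filterᵇ isββ (e ∷ es))
    n = 2 * length (e ∷ es) + 4 * c
    z = lastFrom x xs
    total : + n ≡ potential x ℤ.+ potential z
    total = trans (sym (len-potential (e ∷ es) (walk-edges w)))
      (trans (telescope potential w (IsAugmenting.alternating aug))
             (cong₂ (λ c d → signed c (potential x) ℤ.+ signed d (potential z)) e-unmatched e′-unmatched))
    both : ∀ {u v} → x ≡ u → z ≡ v → + n ≡ potential u ℤ.+ potential v
    both refl refl = total
    6b+6b : ∀ b → 6 * b + 6 * b ≡ 12 * b
    6b+6b = ℕ-Solver.solve-∀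
    mixed : + n ≡ + (6 * b) ℤ.+ + 1 ℤ.+ (+ (6 * b) ℤ.- + 3) → 12 * b ≤ n + 2
    mixed eq = ℕ.≤-reflexive (sym (ℤ.+-injective (trans (cong (λ m → m ℤ.+ + 2) eq)
      (trans (identity (+ (6 * b))) (cong +_ (6b+6b b))))))
      where
      identity : ∀ s → s ℤ.+ + 1 ℤ.+ (s ℤ.- + 3) ℤ.+ + 2 ≡ s ℤ.+ s
      identity = solve-∀
    bound : (x ≡ p 0) ⊎ (x ≡ β b) → (z ≡ p 0) ⊎ (z ≡ β b) → 12 * b ≤ n + 2
    -- Here the potentials add up to 12 b + 2, above the 12 b - 2 of the mixed case.
    bound (inj₁ x≡p) (inj₁ z≡p) = ℕ.≤-trans
      (ℕ.≤-reflexive (sym (6b+6b b))) (ℕ.≤-trans (ℕ.m≤m+n _ 2) (ℕ.≤-trans (ℕ.≤-reflexive (sym (ℤ.+-injective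
        (trans (both x≡p z≡p) (trans (cong₂ ℤ._+_ potential-p potential-p) (identity (+ (6 * b)))))))) (ℕ.m≤m+n n 2)))
      where
      identity : ∀ s → s ℤ.+ + 1 ℤ.+ (s ℤ.+ + 1) ≡ s ℤ.+ s ℤ.+ + 2
      identity = solve-∀
    bound (inj₁ x≡p) (inj₂ z≡β) = mixed (trans (both x≡p z≡β) (cong₂ ℤ._+_ potential-p potential-β))
    bound (inj₂ x≡β) (inj₁ z≡p) = mixed (trans (both x≡β z≡p)
      (trans (cong₂ ℤ._+_ potential-β potential-p) (ℤ.+-comm (+ (6 * b) ℤ.- + 3) (+ (6 * b) ℤ.+ + 1))))
    bound (inj₂ x≡β) (inj₂ z≡β) = contradiction
      (ℕ.+-cancelˡ-≤ (degree M (β b)) 2 1 (begin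
        degree M (β b) + 2
          ≡⟨ cong (λ k → degree M (β b) + (k + k)) (δ-self (β b)) ⟨
        degree M (β b) + (δ (β b) (β b) + δ (β b) (β b))
          ≡⟨ cong₂ (λ u v → degree M (β b) + (δ (β b) u + δ (β b) v)) x≡β z≡β ⟨
        degree M (β b) + (δ (β b) x + δ (β b) z)
          ≡⟨ degree-⊕ A refl refl (IsAugmenting.alternating aug) e-unmatched e′-unmatched (β b) ⟨
        degree (M ⊕ A) (β b)
          ≤⟨ IsAugmenting.result aug (subst (_∈ vertices) x≡β (proj₁ x-free)) ⟩
        degree M (β b) + deficiency (β b)
          ≡⟨ cong (_+_ (degree M (β b))) deficiency-β ⟩
        degree M (β b) + 1 ∎))
      (λ { (s≤s ()) })
      where open ℕ.≤-Reasoning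

  augmenting-length : (A : Trail) → IsAugmenting A → 4 * b + 1 ≤ len A
  augmenting-length A aug with potential-ends A aug
  ... | c , c<b , 12b≤ = len-bound {c = c} 12b≤ c<b

module EG-Properties (b : ℕ) (b≥2 : 2 ≤ b) (b-even : odd b ≡ false) where
  open EG b b≥2
  open Graph graph using (vertices; edges; ends-vertices)
  open Potential b b≥2 b-even

  -- The blossoms B_i

  level : Vertex → ℕ
  level (β i)   = i
  level β₁′     = 1
  level (s i _) = i
  level (p _)   = 0

  V-level : ∀ i → All (λ v → level v ≤ suc i) V[ B (suc i) ]
  V-level zero    = ℕ.≤-refl ∷ ℕ.≤-refl ∷ ℕ.≤-refl ∷ []
  V-level (suc i) = ℕ.≤-refl ∷ All.++⁺ (All.map ℕ.m≤n⇒m≤1+n (V-level i)) (ℕ.≤-refl ∷ ℕ.≤-refl ∷ ℕ.≤-refl ∷ [])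

  -- Away from the path of the `p k`, `level` is the index of the smallest blossom containing a
  -- vertex, so a larger level certifies that the vertex is not yet inside.
  V-outside : ∀ i {v} → suc i < level v → v ∉ V[ B (suc i) ]
  V-outside i i<v v∈ = ℕ.<⇒≱ i<v (All.lookup (V-level i) v∈)

  V-step : ∀ i {v} → v ∈ V[ B (suc i) ] → v ∈ V[ B (suc (suc i)) ]
  V-step i v∈ = there (∈-++⁺ˡ v∈)

  β₁′∈V : ∀ i → β₁′ ∈ V[ B (suc i) ]
  β₁′∈V zero    = there (here refl)
  β₁′∈V (suc i) = V-step i (β₁′∈V i)

  β∈V : ∀ i {k} → k ≤ i → β (suc k) ∈ V[ B (suc i) ]
  β∈V zero    z≤n = here refl
  β∈V (suc i) k≤ with ℕ.m≤n⇒m<n∨m≡n k≤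
  ... | inj₁ k<   = V-step i (β∈V i (ℕ.≤-pred k<))
  ... | inj₂ refl = here refl

  s₁∈V : ∀ i → s (suc i) 1 ∈ V[ B (suc i) ]
  s₁∈V zero    = there (there (here refl))
  s₁∈V (suc i) = there (∈-++⁺ʳ V[ B (suc i) ] (there (there (here refl))))

  S⊆V : ∀ i → All (_∈ V[ B (suc i) ]) (S (suc i))
  S⊆V zero    = s₁∈V 0 ∷ []
  S⊆V (suc i) = s₁∈V (suc i)
              ∷ there (∈-++⁺ʳ V[ B (suc i) ] (there (here refl)))
              ∷ there (∈-++⁺ʳ V[ B (suc i) ] (here refl))
              ∷ All.map (V-step i) (S⊆V i)

  -- The far end has a larger level and so lies outside, and the M-types of successive `ββ`
  -- alternate by parity. The argument includes the artificial base edge of B_b.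
  baseEdge-correct : ∀ i → IsBaseEdge (B (suc i)) (β (suc i)) (odd (suc i)) (baseEdge (suc i))
  baseEdge-correct i = refl , β (suc (suc i)) , V-outside i ℕ.≤-refl , inj₁ refl

  atoms-compatible : ∀ {u v} → u ≢ v → Compatible (atom u) (atom v)
  atoms-compatible u≢v = inj₂ λ { (here refl , here refl) → u≢v refl }

  -- Induction on the index. The closed trail runs from the new base through the contracted inner
  -- blossom and back along `s` 3, 2, 1; its first and last edges share the parity of the new index.
  isBlossom : ∀ i → suc i ≤ b → IsBlossom (B (suc i)) (β (suc i)) (odd (suc i))
  isBlossom zero _ = atomBase
    (record
      { isWalk =
          step (∈-edges⁺ β₁β₁′) (β 1 , β₁′ , here refl , here refl , inj₁ refl)
          (step (∈-edges⁺ β₁′s₂₄) (β₁′ , s 1 1 , here refl , here refl , inj₁ refl)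
          (step (∈-edges⁺ β₁s₂₄) (s 1 1 , β 1 , here refl , here refl , inj₂ refl) single))
      ; distinct = ((λ ()) ∷ (λ ()) ∷ []) ∷ ((λ ()) ∷ []) ∷ [] ∷ []
      ; compatible = (atoms-compatible (λ ()) ∷ atoms-compatible (λ ()) ∷ [])
                   ∷ (atoms-compatible (λ ()) ∷ []) ∷ [] ∷ []
      })
    (turn (atAtom (λ ())) (turn (atAtom (λ ())) end))
    (just refl) (just refl)
  isBlossom (suc i) i<b = atomBase
    (record
      { isWalk =
          step (∈-edges⁺ (ββ 2≤ i<b)) (β (suc (suc i)) , β (suc i) , here refl , β∈V i ℕ.≤-refl , inj₂ refl)
          (step (∈-edges⁺ (ss₃ 2≤ i<b)) (s (suc i) 1 , s (suc (suc i)) 3 , s₁∈V i , here refl , inj₂ refl)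
          (step (∈-edges⁺ (ss₂ 2≤ i<b)) (s (suc (suc i)) 3 , s (suc (suc i)) 2 , here refl , here refl , inj₂ refl)
          (step (∈-edges⁺ (ss₁ 2≤ i<b)) (s (suc (suc i)) 2 , s (suc (suc i)) 1 , here refl , here refl , inj₂ refl)
          (step (∈-edges⁺ (βs 2≤ i<b)) (s (suc (suc i)) 1 , β (suc (suc i)) , here refl , here refl , inj₂ refl)
          single))))
      ; distinct = ((λ ()) ∷ (λ ()) ∷ (λ ()) ∷ (λ ()) ∷ []) ∷ ((λ ()) ∷ (λ ()) ∷ (λ ()) ∷ [])
                 ∷ ((λ ()) ∷ (λ ()) ∷ []) ∷ ((λ ()) ∷ []) ∷ [] ∷ []
      ; compatible = (inj₂ (λ { (here refl , v∈) → V-outside i ℕ.≤-refl v∈ })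
                        ∷ atoms-compatible (λ ()) ∷ atoms-compatible (λ ()) ∷ atoms-compatible (λ ()) ∷ [])
                   ∷ (s-outside ∷ s-outside ∷ s-outside ∷ [])
                   ∷ (atoms-compatible (λ ()) ∷ atoms-compatible (λ ()) ∷ [])
                   ∷ (atoms-compatible (λ ()) ∷ []) ∷ [] ∷ []
      })
    -- The trail enters the inner blossom on that blossom's base edge, so it may leave on an edge of
    -- either type; at the three `s` vertices it alternates.
    (turn (atBlossom (isBlossom i (ℕ.<⇒≤ i<b)) (inj₁ (baseEdge-correct i)))
    (turn (atAtom (not-¬ refl ∘ sym)) (turn (atAtom (not-¬ refl)) (turn (atAtom (not-¬ refl ∘ sym)) end))))
    (just refl) (just refl)
    where
    2≤ : 2 ≤ suc (suc i)
    2≤ = s≤s (s≤s z≤n)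
    s-outside : ∀ {j} → Compatible (B (suc i)) (atom (s (suc (suc i)) j))
    s-outside = inj₂ λ { (v∈ , here refl) → V-outside i ℕ.≤-refl v∈ }

  S-∷ : ∀ m → S (suc m) ≡ s (suc m) 1 ∷ drop 1 (S (suc m))
  S-∷ zero    = refl
  S-∷ (suc m) = refl

  length-S : ∀ m → length (S (suc m)) ≡ suc (m * 3)
  length-S zero    = refl
  length-S (suc m) = cong (3 +_) (length-S m)

  -- Alternating trails of decreasing rank

  module Runs (i : ℕ) (1≤i : 1 ≤ i) (i≤b : i ≤ b) where

    -- Decreases along T i, which therefore repeats no edge.
    rank : Edge → ℕ × ℕ
    rank (pp k)    = 0 , k
    rank (cross _) = 1 , 0
    -- T_i uses `ββ k` on the initial descent if k > i and on the final ascent if k ≤ i; the two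
    -- stages need ranks of opposite monotonicity in k.
    rank (ββ k)    = if does (k ℕ.≤? i) then (2 , i ∸ k) else (7 , k)
    rank β₁β₁′     = 3 , 0
    rank β₁′s₂₄    = 4 , 0
    -- Three consecutive values per index, so that `ss₃ (suc k)` comes just above `ss₁ k`.
    rank (ss₃ k)   = 5 , k * 3
    rank (ss₂ k)   = 5 , 1 + k * 3
    rank (ss₁ k)   = 5 , 2 + k * 3
    rank (βs _)    = 6 , 0
    rank β₁s₂₄     = 6 , 0

    rank-ascending : ∀ {k} → k ≤ i → rank (ββ k) ≡ (2 , i ∸ k)
    rank-ascending {k} k≤i = cong (if_then (2 , i ∸ k) else (7 , k)) (dec-true (k ℕ.≤? i) k≤i)

    rank-descending : ∀ {k} → i < k → rank (ββ k) ≡ (7 , k)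
    rank-descending {k} i<k = cong (if_then (2 , i ∸ k) else (7 , k)) (dec-false (k ℕ.≤? i) (ℕ.<⇒≱ i<k))

    Before : Edge → Edge → Set
    Before e e′ = M e ≢ M e′ × rank e′ ≺ rank e

    -- The vertices are x ∷ xs, the first edge is e, and the last edge has M-type t.
    data Run (v : Vertex) (t : Bool) : (e : Edge) (x : Vertex) (xs : List Vertex) → Set where
      stop : ∀ {e x} → e ∈ edges → Joins e x v → M e ≡ t → Run v t e x (v ∷ [])
      next : ∀ {e e′ x y ys} → e ∈ edges → Joins e x y → Before e e′ → Run v t e′ y ys → Run v t e x (y ∷ ys)

    firstS : ℕ → Edge
    firstS zero    = β₁′s₂₄
    firstS (suc m) = ss₁ (suc (suc m))

    toS : ℕ → Edge
    toS zero    = β₁s₂₄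
    toS (suc m) = βs (suc (suc m))

    -- The first edge of a descent from β_{a+n} to β_a that goes on with `e`; an empty descent
    -- starts with `e` itself.
    topEdge : Edge → ℕ → ℕ → Edge
    topEdge e a zero    = e
    topEdge e a (suc n) = ββ (a + suc n)

    topEdge-type : ∀ {e a} → M e ≡ odd a → ∀ n → M (topEdge e a n) ≡ odd (a + n)
    topEdge-type {a = a} type zero    = trans type (cong odd (sym (ℕ.+-identityʳ a)))
    topEdge-type         type (suc n) = refl

    module _ {v : Vertex} {t : Bool} where

      laterEdges : ∀ {e x xs} → Run v t e x xs → List Edge
      laterEdges (stop _ _ _)              = []
      laterEdges (next {e′ = e′} _ _ _ r)  = e′ ∷ laterEdges r

      run-walk : ∀ {e x xs} (r : Run v t e x xs) → IsWalk Joins (x ∷ xs) (e ∷ laterEdges r)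
      run-walk (stop e∈ j _)   = step e∈ j single
      run-walk (next e∈ j _ r) = step e∈ j (run-walk r)

      run-before : ∀ {e x xs} (r : Run v t e x xs) → Linked Before (e ∷ laterEdges r)
      run-before (stop _ _ _)     = [-]
      run-before (next _ _ before r) = before ∷ run-before r

      run-end : ∀ {e x xs} → Run v t e x xs → lastFrom x xs ≡ v
      run-end (stop _ _ _)   = refl
      run-end (next _ _ _ r) = run-end r

      run-type : ∀ {e x xs} (r : Run v t e x xs) → M (lastFrom e (laterEdges r)) ≡ t
      run-type (stop _ _ m)   = m
      run-type (next _ _ _ r) = run-type r

      toTrail : ∀ {e x xs} → Run v t e x xs → Trail
      toTrail {e} {x} {xs} r = record
        { verts    = x ∷ xs
        ; route    = e ∷ laterEdges r
        ; isWalk   = run-walk r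
        ; distinct = AllPairs.map (λ { {e} lt refl → ≺-irrefl {rank e} lt })
            (Linked⇒AllPairs {R = λ e e′ → rank e′ ≺ rank e} (flip ≺-trans)
              (Linked.map proj₂ (run-before r)))
        }

      toTrail-alternating : ∀ {e x xs} (r : Run v t e x xs) → Alternating (toTrail r)
      toTrail-alternating r = Linked.map proj₁ (run-before r)

      -- What follows the return to β_i, for an arbitrary arriving edge of the right M-type. The
      -- bound (1 , 0) is the rank of the cross edge. Both the sat and the trail stopping at β_i are
      -- obtained by choosing a continuation.
      Continuation : List Vertex → Set
      Continuation rest = ∀ {e x} → e ∈ edges → Joins e x (β i) → M e ≡ odd i → (1 , 0) ≺ rank e →
                          Run v t e x (β i ∷ rest)

      -- The recursion is on the number `n` of edges still to climb, as `k` itself grows towards i.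
      ascend : ∀ {rest} → Continuation rest → ∀ n k → 2 ≤ k → k + n ≡ i →
               Run v t (ββ k) (β (k ∸ 1)) (map β [ k ⋯ i ] ++ rest)
      ascend {rest} cont zero k 2≤k k+0≡i
        rewrite trans (sym (ℕ.+-identityʳ k)) k+0≡i | range-single i =
        cont (∈-edges⁺ (ββ 2≤k i≤b)) (inj₁ refl) refl
          (subst ((1 , 0) ≺_) (sym (rank-ascending (ℕ.≤-refl {i}))) (inj₁ (s≤s (s≤s z≤n))))
      ascend {rest} cont (suc n) k 2≤k k+1+n≡i
        rewrite range-∷ (ℕ.m+n≤o⇒m≤o k (ℕ.≤-reflexive k+1+n≡i)) =
        next (∈-edges⁺ (ββ 2≤k (ℕ.≤-trans k≤i i≤b))) (inj₁ refl)
          (not-¬ refl , subst₂ _≺_ (sym (rank-ascending k<i)) (sym (rank-ascending k≤i))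
                          (inj₂ (refl , ℕ.∸-monoʳ-< (ℕ.n<1+n k) k<i)))
          (ascend cont n (suc k) (ℕ.m≤n⇒m≤1+n 2≤k) (trans (sym (ℕ.+-suc k n)) k+1+n≡i))
        where
        k<i : suc k ≤ i
        k<i = ℕ.m+n≤o⇒m≤o (suc k) (ℕ.≤-reflexive (trans (sym (ℕ.+-suc k n)) k+1+n≡i))
        k≤i : k ≤ i
        k≤i = ℕ.<⇒≤ k<i

      from-β₁′ : ∀ {rest} → Continuation rest → Run v t β₁β₁′ β₁′ (map β [ 1 ⋯ i ] ++ rest)
      from-β₁′ cont with ℕ.m≤n⇒m<n∨m≡n 1≤i
      -- For i = 1 there is nothing to climb: `β₁β₁′` already arrives at β_i, and it is matched as 1
      -- is odd.
      ... | inj₂ refl = cont (∈-edges⁺ β₁β₁′) (inj₂ refl) refl (inj₁ (s≤s (s≤s z≤n)))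
      ... | inj₁ 2≤i rewrite range-∷ 1≤i =
        next (∈-edges⁺ β₁β₁′) (inj₂ refl)
          ((λ ()) , subst (_≺ (3 , 0)) (sym (rank-ascending 2≤i)) (inj₁ ℕ.≤-refl))
          (ascend cont (i ∸ 2) 2 ℕ.≤-refl (ℕ.m+[n∸m]≡n 2≤i))

      -- The index i of the later ascent stays fixed while `m` decreases: after three edges S
      -- continues with the S of the next smaller index, down to s₁₁.
      from-S : ∀ {rest} → Continuation rest → ∀ m → suc m ≤ b →
               Run v t (firstS m) (s (suc m) 1) (drop 1 (S (suc m)) ++ β₁′ ∷ map β [ 1 ⋯ i ] ++ rest)
      from-S cont zero    _   = next (∈-edges⁺ β₁′s₂₄) (inj₂ refl) ((λ ()) , inj₁ ℕ.≤-refl) (from-β₁′ cont)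
      from-S cont (suc m) m<b rewrite S-∷ m =
        next (∈-edges⁺ (ss₁ 2≤ m<b)) (inj₁ refl) (not-¬ refl ∘ sym , inj₂ (refl , ℕ.≤-refl))
        (next (∈-edges⁺ (ss₂ 2≤ m<b)) (inj₁ refl) (not-¬ refl , inj₂ (refl , ℕ.≤-refl))
        (next (∈-edges⁺ (ss₃ 2≤ m<b)) (inj₁ refl) (first m) (from-S cont m (ℕ.<⇒≤ m<b))))
        where
        2≤ : 2 ≤ suc (suc m)
        2≤ = s≤s (s≤s z≤n)
        first : ∀ m → Before (ss₃ (suc (suc m))) (firstS m)
        first zero    = (λ ()) , inj₁ ℕ.≤-refl
        first (suc m) = not-¬ refl ∘ sym , inj₂ (refl , ℕ.≤-refl)

      from-βᵢ : ∀ {rest} → Continuation rest → ∀ m → suc m ≤ b →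
                Run v t (toS m) (β (suc m)) (S (suc m) ++ β₁′ ∷ map β [ 1 ⋯ i ] ++ rest)
      from-βᵢ cont zero    m<b = next (∈-edges⁺ β₁s₂₄) (inj₁ refl) ((λ ()) , inj₁ (s≤s (s≤s (s≤s (s≤s (s≤s z≤n))))))
                                  (from-S cont 0 m<b)
      from-βᵢ cont (suc m) m<b = next (∈-edges⁺ (βs (s≤s (s≤s z≤n)) m<b)) (inj₁ refl)
                                  (not-¬ refl , inj₁ ℕ.≤-refl) (from-S cont (suc m) m<b)

      -- Prepends the descent from β_{a+n} to any run from β_a whose first edge has M-type `odd a`.
      -- It serves for a = i, giving T_i, and for a = i + 1, giving a short trail straight down to
      -- β_i.
      descend : ∀ {e a xs} → i ≤ a → M e ≡ odd a → (∀ {k} → a < k → rank e ≺ (7 , k)) →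
                Run v t e (β a) xs → ∀ n → a + n ≤ b →
                Run v t (topEdge e a n) (β (a + n)) (map β (applyDownFrom (a +_) n) ++ xs)
      descend {e} {a} i≤a type lt r zero    _     = subst (λ k → Run v t e (β k) _) (sym (ℕ.+-identityʳ a)) r
      descend {e} {a} i≤a type lt r (suc n) a+n<b =
        next (∈-edges⁺ (ββ (ℕ.≤-trans (s≤s (ℕ.≤-trans 1≤i i≤a)) a<a+1+n) a+n<b))
             (inj₂ (cong (λ k → β k , β (a + suc n)) (cong (_∸ 1) (ℕ.+-suc a n))))
             (alternates n , subst (rank (topEdge e a n) ≺_)
                          (sym (rank-descending (ℕ.≤-trans (s≤s i≤a) a<a+1+n))) (lower n))
             (descend i≤a type lt r n (ℕ.≤-trans (ℕ.+-monoʳ-≤ a (ℕ.n≤1+n n)) a+n<b))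
        where
        a<a+1+n : ∀ {n} → a < a + suc n
        a<a+1+n {n} = ℕ.≤-trans (s≤s (ℕ.m≤m+n a n)) (ℕ.≤-reflexive (sym (ℕ.+-suc a n)))
        alternates : ∀ n → odd (a + suc n) ≢ M (topEdge e a n)
        alternates n eq = not-¬ refl (trans (sym (topEdge-type type n)) (trans (sym eq) (cong odd (ℕ.+-suc a n))))
        lower : ∀ n → rank (topEdge e a n) ≺ (7 , a + suc n)
        lower zero    = lt a<a+1+n
        lower (suc n) = subst (_≺ (7 , a + suc (suc n))) (sym (rank-descending (ℕ.≤-trans (s≤s i≤a) a<a+1+n)))
                          (inj₂ (refl , ℕ.+-monoʳ-< a (ℕ.n<1+n (suc n))))

  length-βs : ∀ a n → length (map β (applyDownFrom (a +_) n)) ≡ n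
  length-βs a n = trans (List.length-map β (applyDownFrom (a +_) n)) (List.length-applyDownFrom (a +_) n)

  -- A smaller S is a tail of a larger one. The edge from the displayed vertex into that tail is the
  -- petal on which the smaller blossom is entered.
  S-split : ∀ {m n} → n < m → ∃[ xs ] S (suc m) ≡ xs ++ s (suc (suc n)) 3 ∷ S (suc n)
  S-split {suc m} {n} (s≤s n≤m) with ℕ.m≤n⇒m<n∨m≡n n≤m
  ... | inj₂ refl = s (suc (suc n)) 1 ∷ s (suc (suc n)) 2 ∷ [] , refl
  ... | inj₁ n<m with S-split n<m
  ...   | xs , eq = s (suc (suc m)) 1 ∷ s (suc (suc m)) 2 ∷ s (suc (suc m)) 3 ∷ xs
                  , cong (λ ys → s (suc (suc m)) 1 ∷ s (suc (suc m)) 2 ∷ s (suc (suc m)) 3 ∷ ys) eq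

  joins-cross : ∀ e {i k} → Joins e (β i) (p k) → e ≡ cross i
  joins-cross β₁β₁′     (inj₁ ())
  joins-cross β₁β₁′     (inj₂ ())
  joins-cross β₁s₂₄     (inj₁ ())
  joins-cross β₁s₂₄     (inj₂ ())
  joins-cross β₁′s₂₄    (inj₁ ())
  joins-cross β₁′s₂₄    (inj₂ ())
  joins-cross (ββ _)    (inj₁ ())
  joins-cross (ββ _)    (inj₂ ())
  joins-cross (βs _)    (inj₁ ())
  joins-cross (βs _)    (inj₂ ())
  joins-cross (ss₁ _)   (inj₁ ())
  joins-cross (ss₁ _)   (inj₂ ())
  joins-cross (ss₂ _)   (inj₁ ())
  joins-cross (ss₂ _)   (inj₂ ())
  joins-cross (ss₃ _)   (inj₁ ())
  joins-cross (ss₃ _)   (inj₂ ())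
  joins-cross (pp _)    (inj₁ ())
  joins-cross (pp _)    (inj₂ ())
  joins-cross (cross _) (inj₁ refl) = refl
  joins-cross (cross _) (inj₂ ())

  -- The left side is the largest index of a path edge used by any T_i, reached at i = 1.
  pp-bound : 3 * (b ∸ 1) < 3 * b ∸ 2
  pp-bound = ℕ.m+n≤o⇒m≤o∸n (suc (3 * (b ∸ 1))) (begin
    suc (3 * (b ∸ 1)) + 2   ≡⟨ identity (b ∸ 1) ⟩
    3 * suc (b ∸ 1)         ≡⟨ cong (3 *_) (ℕ.m+[n∸m]≡n (ℕ.<⇒≤ b≥2)) ⟩
    3 * b                   ∎)
    where
    open ℕ.≤-Reasoning
    identity : ∀ n → suc (3 * n) + 2 ≡ 3 * suc n
    identity = ℕ-Solver.solve-∀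

  β-free : Free (β b)
  β-free = proj₂ (All.lookup ends-vertices (∈-edges⁺ (ββ b≥2 ℕ.≤-refl)))
         , ℕ.m<m+n (degree M (β b)) (ℕ.≤-reflexive (sym deficiency-β))

  p-free : Free (p 0)
  p-free = proj₁ (All.lookup ends-vertices (∈-edges⁺ (pp (ℕ.≤-trans (s≤s z≤n) pp-bound))))
         , ℕ.m<m+n (degree M (p 0)) ℕ.≤-refl

  -- Augmenting along a trail from β_b to p₀ uses up exactly the deficiencies, so the result is
  -- again an f-matching.
  δ-deficiency : ∀ v → δ v (β b) + δ v (p 0) ≤ deficiency v
  δ-deficiency v = by (v ≟ⱽ p 0) (v ≟ⱽ β b)
    where
    by : Dec (v ≡ p 0) → Dec (v ≡ β b) → δ v (β b) + δ v (p 0) ≤ deficiency v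
    by (yes refl) _ = ℕ.≤-refl
    by (no _) (yes refl) = ℕ.≤-reflexive (trans (cong (_+ 0) (δ-self (β b))) (sym deficiency-β))
    by (no v≢p) (no v≢β) = ℕ.≤-trans (ℕ.≤-reflexive
      (cong₂ (λ c d → indicator c + indicator d) (dec-false (β b ≟ⱽ v) (v≢β ∘ sym)) (dec-false (p 0 ≟ⱽ v) (v≢p ∘ sym)))) z≤n

  -- The trail T i for i = suc m.
  module Tour (m : ℕ) (m<b : suc m ≤ b) where
    open Runs (suc m) (s≤s z≤n) m<b

    d : ℕ
    d = b ∸ suc m

    i+d≡b : suc m + d ≡ b
    i+d≡b = ℕ.m+[n∸m]≡n m<b

    run-augmenting : ∀ {e x xs} (r : Run (p 0) unmatched e x xs) → x ≡ β b → M e ≡ unmatched →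
                     IsAugmenting (toTrail r)
    run-augmenting {e} {x} {xs} r refl first = record
      { alternating      = toTrail-alternating r
      ; starts-free      = just β-free
      ; ends-free        = subst (MaybeAny.Any Free)
                                 (sym (trans (last-∷ x xs) (cong Maybe.just (run-end r)))) (just p-free)
      ; starts-unmatched = just first
      ; ends-unmatched   = subst (MaybeAny.Any (λ e → M e ≡ unmatched))
                                 (sym (last-∷ e (laterEdges r))) (just (run-type r))
      ; result           = λ {v} _ → begin
          degree (M ⊕ toTrail r) v
            ≡⟨ degree-⊕ (toTrail r) refl refl (toTrail-alternating r) first (run-type r) v ⟩
          degree M v + (δ v (β b) + δ v (lastFrom x xs))
            ≡⟨ cong (λ u → degree M v + (δ v (β b) + δ v u)) (run-end r) ⟩
          degree M v + (δ v (β b) + δ v (p 0))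
            ≤⟨ ℕ.+-monoʳ-≤ (degree M v) (δ-deficiency v) ⟩
          degree M v + deficiency v ∎
      }
      where open ℕ.≤-Reasoning

    run-reaches : ∀ {v t e x xs} (r : Run v t e x xs) → x ≡ β b → M e ≡ unmatched →
                  Reaches (toTrail r) v t
    run-reaches {e = e} {x} {xs} r refl first = record
      { alternating      = toTrail-alternating r
      ; starts-free      = just β-free
      ; starts-unmatched = MaybeAll.just first
      ; ends-at          = trans (last-∷ x xs) (cong Maybe.just (run-end r))
      ; ends-type        = trans (cong (maybe′ M matched) (last-∷ e (laterEdges r))) (run-type r)
      }

    run-p : ∀ k → k < 3 * b ∸ 2 → Run (p 0) unmatched (pp k) (p (suc k)) (map p (downFrom (suc k)))
    run-p zero    k< = stop (∈-edges⁺ (pp k<)) (inj₂ refl) refl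
    run-p (suc k) k< = next (∈-edges⁺ (pp k<)) (inj₂ refl) (not-¬ refl ∘ sym , inj₂ (refl , ℕ.≤-refl))
                         (run-p k (ℕ.<⇒≤ k<))

    to-p : Continuation (map p (downFrom (2 + 3 * d)))
    to-p e∈ j type lt =
      next e∈ j ((λ eq → not-¬ refl (trans (sym type) eq)) , lt)
      -- The cross edge has the type opposite to `odd i`, and the path edge after it again has type
      -- `odd i`.
      (next (∈-edges⁺ (cross (s≤s z≤n) m<b)) (inj₁ refl)
         ((λ eq → not-¬ refl (trans (sym (odd-complement m<b)) (sym eq))) , inj₁ ℕ.≤-refl)
      (run-p (3 * d) (ℕ.≤-trans (s≤s (ℕ.*-monoʳ-≤ 3 (ℕ.∸-monoʳ-≤ b (s≤s z≤n)))) pp-bound)))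

    firstEdge : Edge
    firstEdge = topEdge (toS m) (suc m) d

    toS-type : ∀ m → M (toS m) ≡ odd (suc m)
    toS-type zero    = refl
    toS-type (suc _) = refl

    toS-rank : ∀ m → rank (toS m) ≡ (6 , 0)
    toS-rank zero    = refl
    toS-rank (suc _) = refl

    start-type : ∀ {k} → k ≡ b → odd k ≡ unmatched
    start-type eq = trans (cong odd eq) b-even

    firstEdge-unmatched : M firstEdge ≡ unmatched
    firstEdge-unmatched = trans (topEdge-type (toS-type m) d) (start-type i+d≡b)

    tour : ∀ {v t rest} → Continuation {v} {t} rest →
           Run v t firstEdge (β (suc m + d))
             (map β (applyDownFrom (suc m +_) d) ++ S (suc m) ++ β₁′ ∷ map β [ 1 ⋯ suc m ] ++ rest)
    tour cont = descend ℕ.≤-refl (toS-type m)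
      (λ _ → subst (_≺ _) (sym (toS-rank m)) (inj₁ ℕ.≤-refl))
      (from-βᵢ cont m m<b) d (ℕ.≤-reflexive i+d≡b)

    -- The vertices of T_i before its ascent reaches β_{n+1}. Its length is therefore the level of
    -- that later occurrence of β_{n+1}.
    prefix : ℕ → List Vertex
    prefix n = map β (applyDownFrom (suc m +_) (suc d)) ++ S (suc m) ++ β₁′ ∷ map β [ 1 ⋯ n ]

    -- The level b + 2 i + j - 1 of β_j, where i = suc m and j = suc n.
    length-prefix : ∀ n → length (prefix n) ≡ b + 2 * suc m + n
    length-prefix n = begin
      length (prefix n)
        ≡⟨ List.length-++ (map β (applyDownFrom (suc m +_) (suc d))) ⟩
      length (map β (applyDownFrom (suc m +_) (suc d))) + length (S (suc m) ++ β₁′ ∷ map β [ 1 ⋯ n ])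
        ≡⟨ cong₂ _+_ (length-βs (suc m) (suc d)) (List.length-++ (S (suc m))) ⟩
      suc d + (length (S (suc m)) + suc (length (map β [ 1 ⋯ n ])))
        ≡⟨ cong₂ (λ k l → suc d + (k + suc l)) (length-S m)
             (trans (List.length-map β [ 1 ⋯ n ]) (length-range 1 n)) ⟩
      suc d + (suc (m * 3) + suc n)
        ≡⟨ identity d m n ⟩
      suc m + d + 2 * suc m + n
        ≡⟨ cong (λ k → k + 2 * suc m + n) i+d≡b ⟩
      b + 2 * suc m + n ∎
      where
      open ≡-Reasoning
      identity : ∀ d m n → suc d + (suc (m * 3) + suc n) ≡ suc m + d + 2 * suc m + n
      identity = ℕ-Solver.solve-∀

    module _ {v : Vertex} {t : Bool} {rest : List Vertex} (cont : Continuation {v} {t} rest) where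

      -- The cut point `n` is arbitrary, so one regrouping serves for the length, for the cross edge
      -- and for every petalevel.
      tour-verts : ∀ {n} → n ≤ suc m →
                   verts (toTrail (tour cont)) ≡ prefix n ++ map β [ suc n ⋯ suc m ] ++ rest
      tour-verts {n} n≤i = sym (begin
        prefix n ++ map β [ suc n ⋯ suc m ] ++ rest
          ≡⟨ List.++-assoc (map β (applyDownFrom (suc m +_) (suc d))) _ _ ⟩
        map β (applyDownFrom (suc m +_) (suc d)) ++ (S (suc m) ++ β₁′ ∷ map β [ 1 ⋯ n ]) ++ map β [ suc n ⋯ suc m ] ++ rest
          ≡⟨ cong (map β (applyDownFrom (suc m +_) (suc d)) ++_) (List.++-assoc (S (suc m)) _ _) ⟩
        map β (applyDownFrom (suc m +_) (suc d)) ++ S (suc m) ++ β₁′ ∷ map β [ 1 ⋯ n ] ++ map β [ suc n ⋯ suc m ] ++ rest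
          ≡⟨ cong (λ xs → map β (applyDownFrom (suc m +_) (suc d)) ++ S (suc m) ++ β₁′ ∷ xs)
               (trans (sym (List.++-assoc (map β [ 1 ⋯ n ]) _ rest))
                 (cong (_++ rest) (trans (sym (List.map-++ β [ 1 ⋯ n ] _)) (cong (map β) (range-++ n≤i))))) ⟩
        map β (applyDownFrom (suc m +_) (suc d)) ++ S (suc m) ++ β₁′ ∷ map β [ 1 ⋯ suc m ] ++ rest ∎)
        where open ≡-Reasoning

      tour-len : len (toTrail (tour cont)) ≡ b + 2 * suc m + m + length rest
      tour-len = ℕ.suc-injective (begin
        suc (len (toTrail (tour cont)))
          ≡⟨ walk-length (isWalk (toTrail (tour cont))) ⟨
        length (verts (toTrail (tour cont)))
          ≡⟨ cong length (tour-verts (ℕ.n≤1+n m)) ⟩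
        length (prefix m ++ map β [ suc m ⋯ suc m ] ++ rest)
          ≡⟨ trans (List.length-++ (prefix m)) (cong₂ _+_ (length-prefix m)
               (cong (λ xs → length (map β xs ++ rest)) (range-single (suc m)))) ⟩
        b + 2 * suc m + m + suc (length rest)
          ≡⟨ ℕ.+-suc (b + 2 * suc m + m) (length rest) ⟩
        suc (b + 2 * suc m + m + length rest) ∎)
        where open ≡-Reasoning

    sat : Trail
    sat = toTrail (tour to-p)

    sat-verts : verts sat ≡ T (suc m)
    sat-verts = sym (cong (λ xs → map β xs ++ S (suc m) ++ β₁′ ∷ map β [ 1 ⋯ suc m ] ++ map p (downFrom (2 + 3 * d)))
      (subst (λ k → reverse [ suc m ⋯ k ] ≡ (suc m + d) ∷ applyDownFrom (suc m +_) d) i+d≡b (reverse-range (suc m) d)))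

    sat-len : len sat ≡ 4 * b + 1
    sat-len = begin
      len sat
        ≡⟨ tour-len to-p ⟩
      b + 2 * suc m + m + length (map p (downFrom (2 + 3 * d)))
        ≡⟨ cong (b + 2 * suc m + m +_) (trans (List.length-map p (downFrom (2 + 3 * d))) (List.length-downFrom (2 + 3 * d))) ⟩
      b + 2 * suc m + m + (2 + 3 * d)
        ≡⟨ identity b d m ⟩
      b + 3 * (suc m + d) + 1
        ≡⟨ cong (λ k → b + 3 * k + 1) i+d≡b ⟩
      4 * b + 1 ∎
      where
      open ≡-Reasoning
      identity : ∀ b d m → b + 2 * suc m + m + (2 + 3 * d) ≡ b + 3 * (suc m + d) + 1
      identity = ℕ-Solver.solve-∀

    sat-augmenting : IsAugmenting sat
    sat-augmenting = run-augmenting (tour to-p) (cong β i+d≡b) firstEdge-unmatched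

    isSat : IsSat sat
    isSat = sat-augmenting , λ A aug → ℕ.≤-trans (ℕ.≤-reflexive sat-len) (augmenting-length A aug)

    -- After `prefix m` the trail goes from β_i to a path vertex, and only the cross edge at β_i
    -- joins two such vertices.
    crosses : cross (suc m) ∈ route sat
    crosses with walk-edge (prefix m) (subst (λ xs → IsWalk Joins xs (route sat)) split (isWalk sat))
      where
      split : verts sat ≡ prefix m ++ β (suc m) ∷ map p (downFrom (2 + 3 * d))
      split = trans (tour-verts to-p (ℕ.n≤1+n m)) (cong (λ xs → prefix m ++ map β xs ++ map p (downFrom (2 + 3 * d)))
        (range-single (suc m)))
    ... | e , at , j , _ = subst (_∈ route sat) (joins-cross e j) (proj₁ (at⇒∈ (route sat) (length (prefix m)) at))

    -- Ordinary levels and petalevels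

    stop-here : Continuation {β (suc m)} {odd (suc m)} []
    stop-here e∈ j type _ = stop e∈ j type

    -- Supplies the M-type in which T_i does not return to β_i: go straight down from β_b and stop
    -- after `ββ (suc i)`, which exists because i < b. This takes b - i edges.
    descent : suc m < b → ∃[ A ] Reaches A (β (suc m)) (not (odd (suc m))) × len A ≤ b + 2 * suc m + m
    descent i<b = toTrail r , run-reaches r (cong β a+n≡b) (trans (topEdge-type refl n) (start-type a+n≡b)) , bound
      where
      n = b ∸ suc (suc m)
      a+n≡b = ℕ.m+[n∸m]≡n i<b
      r = descend {v = β (suc m)} {t = not (odd (suc m))} {a = suc (suc m)} (ℕ.n≤1+n (suc m)) refl
            (λ {k} lt → subst (_≺ (7 , k)) (sym (rank-descending (ℕ.n<1+n (suc m)))) (inj₂ (refl , lt)))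
            (stop (∈-edges⁺ (ββ (s≤s (s≤s z≤n)) i<b)) (inj₂ refl) refl) n (ℕ.≤-reflexive a+n≡b)
      len-r : len (toTrail r) ≡ length (map β (applyDownFrom (suc (suc m) +_) n)) + 1
      len-r = ℕ.suc-injective (trans (sym (walk-length (isWalk (toTrail r))))
        (cong suc (List.length-++ (map β (applyDownFrom (suc (suc m) +_) n)))))
      bound : len (toTrail r) ≤ b + 2 * suc m + m
      bound = begin
        len (toTrail r)                                          ≡⟨ len-r ⟩
        length (map β (applyDownFrom (suc (suc m) +_) n)) + 1    ≡⟨ cong (_+ 1) (length-βs (suc (suc m)) n) ⟩
        n + 1                                                    ≤⟨ ℕ.+-mono-≤ (ℕ.m∸n≤m b (suc (suc m))) (s≤s z≤n) ⟩
        b + 2 * suc m                                            ≤⟨ ℕ.m≤m+n _ m ⟩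
        b + 2 * suc m + m                                        ∎
        where open ℕ.≤-Reasoning

    -- An ordinary level is minimal for its M-type, so one trail of each type bounds it: the tour
    -- stopped at β_i for type `odd i`, and `descent` for the other.
    ordinary-bound : suc m < b → ∀ {k} → IsOrdinaryLevel (β (suc m)) k → k ≤ b + 2 * suc m + m
    ordinary-bound i<b {k} (t , A , _ , refl , minimal) with t Bool.≟ odd (suc m)
    ... | yes refl = ℕ.≤-trans
      (minimal (toTrail (tour stop-here)) (run-reaches (tour stop-here) (cong β i+d≡b) firstEdge-unmatched))
      (ℕ.≤-reflexive (trans (tour-len stop-here) (ℕ.+-identityʳ _)))
    ... | no t≢ with descent i<b
    ...   | A′ , reaches , bound = ℕ.≤-trans (minimal A′ (subst (Reaches A′ (β (suc m))) (sym (¬-not t≢)) reaches)) bound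

    module _ {n : ℕ} (n<m : n < m) where

      private
        -- T_i is cut at its last entry into B_{n+1} before the level in question: `u` is the last
        -- vertex outside, and `ys` stays inside and ends at β_{n+1}.
        xs  = map β (applyDownFrom (suc m +_) (suc d)) ++ proj₁ (S-split n<m)
        u   = s (suc (suc n)) 3
        ys  = S (suc n) ++ β₁′ ∷ map β [ 1 ⋯ suc n ]
        zs  = map β [ suc (suc n) ⋯ suc m ] ++ map p (downFrom (2 + 3 * d))

      prefix-entry : prefix (suc n) ≡ xs ++ u ∷ ys
      prefix-entry = trans
        (cong (map β (applyDownFrom (suc m +_) (suc d)) ++_)
          (trans (cong (_++ β₁′ ∷ map β [ 1 ⋯ suc n ]) (proj₂ (S-split n<m))) (List.++-assoc (proj₁ (S-split n<m)) _ _)))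
        (sym (List.++-assoc (map β (applyDownFrom (suc m +_) (suc d))) _ _))

      sat-entry : verts sat ≡ xs ++ u ∷ ys ++ zs
      sat-entry = trans (tour-verts to-p (s≤s (ℕ.<⇒≤ n<m)))
        (trans (cong (_++ zs) prefix-entry) (List.++-assoc xs _ _))

      level-entry : b + 2 * suc m + n ≡ length xs + length ys
      level-entry = ℕ.suc-injective (begin
        suc (b + 2 * suc m + n)        ≡⟨ ℕ.+-suc _ n ⟨
        b + 2 * suc m + suc n          ≡⟨ length-prefix (suc n) ⟨
        length (prefix (suc n))        ≡⟨ trans (cong length prefix-entry) (List.length-++ xs) ⟩
        length xs + suc (length ys)    ≡⟨ ℕ.+-suc (length xs) (length ys) ⟩
        suc (length xs + length ys)    ∎)
        where open ≡-Reasoning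

      level-β : verts sat at b + 2 * suc m + n is β (suc n)
      level-β = subst₂ (λ xs k → xs at k is β (suc n))
        (sym (trans (tour-verts to-p (ℕ.≤-trans (ℕ.n≤1+n n) (s≤s (ℕ.<⇒≤ n<m))))
                    (cong (λ xs → prefix n ++ map β xs ++ map p (downFrom (2 + 3 * d))) (range-∷ (s≤s (ℕ.<⇒≤ n<m))))))
        (length-prefix n) (at-prefix (prefix n))

      enters : ∃[ e ] Enters sat (B (suc n)) (b + 2 * suc m + n) e × IsPetal (B (suc n)) (baseEdge (suc n)) e
      -- Rewriting by `S-∷` exposes s_{n+1,1} right after `u`, so that `walk-edge` yields the
      -- entering edge.
      enters with walk-edge xs (subst (λ vs → IsWalk Joins vs (route sat))
                    (trans sat-entry (cong (λ w → xs ++ u ∷ (w ++ β₁′ ∷ map β [ 1 ⋯ suc n ]) ++ zs) (S-∷ n))) (isWalk sat))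
      ... | e , e-at , j , _ = e
          , (length xs , u , below , subst (_at length xs is u) (sym sat-entry) (at-prefix xs) , u∉ , e-at
            , λ k w l<k k≤ at → at-tail xs inside l<k (ℕ.≤-trans k≤ (ℕ.≤-reflexive level-entry))
                                  (subst (_at k is w) sat-entry at))
          , (u , s (suc n) 1 , j , u∉ , s₁∈V n) , λ { refl → not-base j }
        where
        u∉ : u ∉ V[ B (suc n) ]
        u∉ = V-outside n ℕ.≤-refl
        inside : All (_∈ V[ B (suc n) ]) ys
        inside = All.++⁺ (S⊆V n) (β₁′∈V n ∷ All.map⁺ (All.applyUpTo⁺₁ suc (suc n) (λ k< → β∈V n (ℕ.≤-pred k<))))
        below : length xs < b + 2 * suc m + n
        below = subst (length xs <_) (sym level-entry)
          (ℕ.m<m+n (length xs) (subst (0 <_) (sym (List.length-++ (S (suc n))))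
            (subst (λ k → 0 < k + _) (sym (length-S n)) (s≤s z≤n))))
        not-base : ¬ Joins (ββ (suc (suc n))) u (s (suc n) 1)
        not-base (inj₁ ())
        not-base (inj₂ ())

  petalevel : ∀ {m n} → n < m → m < b → IsPetalevel positive (β (suc n) , b + 2 * suc m + n)
  petalevel {m} {n} n<m m<b with Tour.enters m m<b n<m
  ... | e , entered , petal =
    (sat , isSat , level-β n<m , B (suc n) , baseEdge (suc n)
      , ∈-map⁺ (λ i → B i , baseEdge i) (∈-range⁺ (s≤s z≤n) n<b) , e , entered , petal)
    -- By `ordinary-bound` an ordinary level of β_j is at most b + 3 j - 1, less than b + 2 i + j -
    -- 1 as j < i.
    , λ ordinary → ℕ.<⇒≱ (ℕ.+-monoˡ-< n (ℕ.+-monoʳ-< b (ℕ.*-monoʳ-< 2 (s≤s n<m))))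
                         (Tour.ordinary-bound n n<b (ℕ.≤-trans (s≤s n<m) m<b) ordinary)
    where
    open Tour m m<b
    n<b : n < b
    n<b = ℕ.<-trans n<m m<b

  -- Counting vertices, edges and petalevels

  length-family : {A : Set} (c : ℕ → A) (m n : ℕ) (ys : List A) →
                  length (map c [ m ⋯ n ] ++ ys) ≡ suc n ∸ m + length ys
  length-family c m n ys = trans (List.length-++ (map c [ m ⋯ n ]))
    (cong (_+ length ys) (trans (List.length-map c [ m ⋯ n ]) (length-range m n)))

  1≤b : 1 ≤ b
  1≤b = ℕ.<⇒≤ b≥2

  order-count : order ≡ suc (3 * b ∸ 2) + (b + suc (b + (b ∸ 1 + (b ∸ 1 + 0))))
  order-count = trans (length-family p 0 (3 * b ∸ 2) _) (cong (suc (3 * b ∸ 2) +_)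
    (trans (length-family β 1 b _) (cong (λ n → b + suc n)
    (trans (length-family (λ i → s i 1) 1 b _) (cong (b +_)
    (trans (length-family (λ i → s i 2) 2 b _) (cong (b ∸ 1 +_)
    (length-family (λ i → s i 3) 2 b []))))))))

  size-count : size ≡ 3 + (b ∸ 1 + (b ∸ 1 + (b ∸ 1 + (b ∸ 1 + (b ∸ 1 + (3 * b ∸ 2 + (b + 0)))))))
  size-count = cong (3 +_)
    (trans (length-family ββ 2 b _) (cong (b ∸ 1 +_)
    (trans (length-family βs 2 b _) (cong (b ∸ 1 +_)
    (trans (length-family ss₁ 2 b _) (cong (b ∸ 1 +_)
    (trans (length-family ss₂ 2 b _) (cong (b ∸ 1 +_)
    (trans (length-family ss₃ 2 b _) (cong (b ∸ 1 +_)
    (trans (List.length-++ (map pp (upTo (3 * b ∸ 2)))) (cong₂ _+_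
      (trans (List.length-map pp (upTo (3 * b ∸ 2))) (List.length-upTo (3 * b ∸ 2)))
      (length-family cross 1 b [])))))))))))))

  order-lower : b ≤ order
  order-lower = ℕ.≤-trans (ℕ.≤-trans (ℕ.m≤m+n b _) (ℕ.m≤n+m _ (suc (3 * b ∸ 2)))) (ℕ.≤-reflexive (sym order-count))

  size-lower : b ≤ size
  size-lower = ℕ.≤-trans (ℕ.≤-trans (ℕ.≤-reflexive (sym (ℕ.m∸n+n≡m 1≤b)))
    (ℕ.≤-trans (ℕ.≤-reflexive (ℕ.+-comm (b ∸ 1) 1)) (ℕ.+-mono-≤ {1} {3} (s≤s z≤n) (ℕ.m≤m+n (b ∸ 1) _))))
    (ℕ.≤-reflexive (sym size-count))

  order-upper : order ≤ 9 * b
  order-upper = begin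
    order
      ≡⟨ order-count ⟩
    suc (3 * b ∸ 2) + (b + suc (b + (b ∸ 1 + (b ∸ 1 + 0))))
      -- Each 1 is enlarged to b and each truncated subtraction is dropped.
      ≤⟨ ℕ.+-mono-≤ (ℕ.+-mono-≤ 1≤b (ℕ.m∸n≤m (3 * b) 2)) (ℕ.+-monoʳ-≤ b (ℕ.+-mono-≤ 1≤b
           (ℕ.+-monoʳ-≤ b (ℕ.+-mono-≤ (ℕ.m∸n≤m b 1) (ℕ.+-monoˡ-≤ 0 (ℕ.m∸n≤m b 1)))))) ⟩
    b + 3 * b + (b + (b + (b + (b + (b + 0)))))
      ≡⟨ identity b ⟩
    9 * b ∎
    where
    open ℕ.≤-Reasoning
    identity : ∀ b → b + 3 * b + (b + (b + (b + (b + (b + 0))))) ≡ 9 * b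
    identity = ℕ-Solver.solve-∀

  size-upper : size ≤ 12 * b
  size-upper = begin
    size
      ≡⟨ size-count ⟩
    3 + (b ∸ 1 + (b ∸ 1 + (b ∸ 1 + (b ∸ 1 + (b ∸ 1 + (3 * b ∸ 2 + (b + 0)))))))
      ≤⟨ ℕ.+-mono-≤ (ℕ.*-monoʳ-≤ 3 1≤b) (ℕ.+-mono-≤ b-1≤b (ℕ.+-mono-≤ b-1≤b (ℕ.+-mono-≤ b-1≤b (ℕ.+-mono-≤ b-1≤b
           (ℕ.+-mono-≤ b-1≤b (ℕ.+-monoˡ-≤ (b + 0) (ℕ.m∸n≤m (3 * b) 2))))))) ⟩
    3 * b + (b + (b + (b + (b + (b + (3 * b + (b + 0)))))))
      ≡⟨ identity b ⟩
    12 * b ∎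
    where
    open ℕ.≤-Reasoning
    b-1≤b : b ∸ 1 ≤ b
    b-1≤b = ℕ.m∸n≤m b 1
    identity : ∀ b → 3 * b + (b + (b + (b + (b + (b + (3 * b + (b + 0))))))) ≡ 12 * b
    identity = ℕ-Solver.solve-∀

  -- T₁ is an augmenting trail attaining the lower bound, so no sat can be longer.
  sat-length : ∀ A → IsSat A → len A ≡ 4 * b + 1
  sat-length A (aug , minimal) = ℕ.≤-antisym
    (ℕ.≤-trans (minimal (Tour.sat 0 1≤b) (Tour.sat-augmenting 0 1≤b)) (ℕ.≤-reflexive (Tour.sat-len 0 1≤b)))
    (augmenting-length A aug)

  augmenting-vertices : ∀ A → IsAugmenting A → All (_∈ vertices) (verts A)
  augmenting-vertices record { verts = [] } _ = []
  augmenting-vertices A@record { verts = _ ∷ _ } aug with just x-free ← IsAugmenting.starts-free aug =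
    walk-vertices (isWalk A) (proj₁ x-free)

  -- A petalevel is a vertex of the graph with one of the 4 b + 2 levels of a sat. There are at most
  -- 9 b vertices and 4 b + 2 ≤ 6 b, whence 54.
  petalevels-upper : AtMost (54 * (b * b)) (IsPetalevel positive)
  petalevels-upper xs uxs petalevels = begin
    length xs
      ≤⟨ unique-⊆-length uxs (cartesianProduct vertices (upTo (4 * b + 2))) (λ x∈ → possible (All.lookup petalevels x∈)) ⟩
    length (cartesianProduct vertices (upTo (4 * b + 2)))
      ≡⟨ trans (length-cartesianProduct vertices (upTo (4 * b + 2))) (cong (order *_) (List.length-upTo (4 * b + 2))) ⟩
    order * (4 * b + 2)
      ≤⟨ ℕ.*-mono-≤ order-upper (ℕ.+-monoʳ-≤ (4 * b) (ℕ.*-monoʳ-≤ 2 1≤b)) ⟩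
    9 * b * (4 * b + 2 * b)
      ≡⟨ identity b ⟩
    54 * (b * b) ∎
    where
    open ℕ.≤-Reasoning
    identity : ∀ b → 9 * b * (4 * b + 2 * b) ≡ 54 * (b * b)
    identity = ℕ-Solver.solve-∀
    possible : ∀ {x} → IsPetalevel positive x → x ∈ cartesianProduct vertices (upTo (4 * b + 2))
    possible {v , k} ((A , sat , at , _) , _) with at⇒∈ (verts A) k at
    ... | v∈ , k< = ∈-cartesianProduct⁺ (All.lookup (augmenting-vertices A (proj₁ sat)) v∈)
      (∈-upTo⁺ (ℕ.≤-trans k< (ℕ.≤-reflexive (trans (walk-length (isWalk A))
        (trans (cong suc (sat-length A sat)) (sym (ℕ.+-suc (4 * b) 1)))))))

  -- Take j in the lower half of 1, ..., b and i in the upper half: then j < i always holds, and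
  -- there are h² pairs. The vertex recovers j, and the level then recovers i.
  petalevels-lower : ∀ {h} → b ≡ h * 2 → AtLeast (h * h) (IsPetalevel positive)
  petalevels-lower {h} b≡2h =
      map place pairs
    , Unique.map⁺ place-injective (Unique.cartesianProduct⁺ (Unique.upTo⁺ h) (Unique.upTo⁺ h))
    , All.map⁺ (All.tabulate (λ x∈ → let n∈ , m∈ = ∈-cartesianProduct⁻ (upTo h) (upTo h) x∈ in
        petalevel (ℕ.≤-trans (∈-upTo⁻ n∈) (ℕ.m≤m+n h _)) (h+m<b (∈-upTo⁻ m∈))))
    , ℕ.≤-reflexive (sym (trans (List.length-map place pairs)
        (trans (length-cartesianProduct (upTo h) (upTo h)) (cong₂ _*_ (List.length-upTo h) (List.length-upTo h)))))
    where
    pairs : List (ℕ × ℕ)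
    pairs = cartesianProduct (upTo h) (upTo h)
    place : ℕ × ℕ → Vertex × ℕ
    place (n , m) = β (suc n) , b + 2 * suc (h + m) + n
    place-injective : ∀ {x y} → place x ≡ place y → x ≡ y
    place-injective {n , m} {n′ , m′} eq with cong proj₁ eq
    ... | refl = cong (n ,_) (ℕ.+-cancelˡ-≡ h m m′ (ℕ.suc-injective (ℕ.*-cancelˡ-≡ _ _ 2
      (ℕ.+-cancelˡ-≡ b _ _ (ℕ.+-cancelʳ-≡ n _ _ (cong proj₂ eq))))))
    h+m<b : ∀ {m} → m < h → h + m < b
    h+m<b m<h = ℕ.≤-trans (ℕ.+-monoʳ-< h m<h) (ℕ.≤-reflexive (trans (identity h) (sym b≡2h)))
      where
      identity : ∀ h → h + h ≡ h * 2
      identity = ℕ-Solver.solve-∀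

mainTheorem4 : ∃[ c ] ∃[ C ] (∀ (b : ℕ) (b≥2 : 2 ≤ b) → 2 ∣ b →
    let open EG b b≥2 in
    IsFMatching M
    × (∀ i → 1 ≤ i → i ≤ b →
    IsBlossom (B i) (β i) (odd i) × IsBaseEdge (B i) (β i) (odd i) (baseEdge i))
    × (b ≤ c * order × order ≤ C * b)
    × (b ≤ c * size × size ≤ C * b)
    × (∀ A → IsSat A → len A ≡ 4 * b + 1)
    × (∀ i → 1 ≤ i → i ≤ b →
    ∃[ A ] verts A ≡ T i × cross i ∈ route A × IsSat A)
    × (∃[ m ] AtLeast m (IsPetalevel positive) × b * b ≤ c * m)
    × AtMost (C * (b * b)) (IsPetalevel positive))
-- The constant 4 comes from h² = b² / 4 petalevels, and 54 from `petalevels-upper`; both also cover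
-- the bounds on the numbers of vertices and edges.
mainTheorem4 = 4 , 54 , λ { b b≥2 (divides h b≡2h) →
  let
    b-even = trans (cong odd b≡2h) (odd-*2 h)
    open EG-Properties b b≥2 b-even
  in
    -- `f` is the degree in `M` plus the deficiency.
    (λ _ → ℕ.m≤m+n _ _)
  , (λ { (suc i) _ i<b → isBlossom i i<b , baseEdge-correct i })
  , (ℕ.m≤n⇒m≤o*n 4 order-lower , ℕ.≤-trans order-upper (ℕ.*-monoˡ-≤ b (ℕ.m≤m+n 9 45)))
  , (ℕ.m≤n⇒m≤o*n 4 size-lower , ℕ.≤-trans size-upper (ℕ.*-monoˡ-≤ b (ℕ.m≤m+n 12 42)))
  , sat-length
  , (λ { (suc m) _ m<b → let open Tour m m<b in sat , sat-verts , crosses , isSat })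
  , (h * h , petalevels-lower {h} b≡2h , ℕ.≤-reflexive (trans (cong₂ _*_ b≡2h b≡2h) (square h)))
  , petalevels-upper }
  where
  square : ∀ h → h * 2 * (h * 2) ≡ 4 * (h * h)
  square = ℕ-Solver.solve-∀
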